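{- Let $x$ be an indeterminate. For every $n\ge1$, the generating polynomial of rooted trees on $n$ labelled vertices enriched with set partitions, each block weighted with $x$, is $$\mathcal{A}_{e^{x(e^t-1)}}[n]=T_{n-1}(nx),$$ where $T_m(x)$ is the Touchard polynomial. In particular, the number of rooted trees on $n$ labelled vertices enriched with set partitions is $T_{n-1}(n)$.
   Context: The Touchard polynomials are defined by $\sum_{m\ge0}T_m(x)\frac{t^m}{m!}=e^{x(e^t-1)}$. A rooted tree enriched with set partitions is a (non-plane) rooted tree $T$ on the vertex set $\{1,\dots,n\}$ together with, for each vertex $v$, a set partition of the set $T^{ -1}(v)$ of children of $v$; its weight is $x$ raised to the total number of blocks of these partitions. $\mathcal{A}_{e^{x(e^t-1)}}[n]$ is the sum of the weights of all of these; equivalently, $\mathcal{A}_G(t)=\sum_{n\ge1}\mathcal{A}_G[n]\frac{t^n}{n!}$ is the solution of $\mathcal{A}_G(t)=t\,G(\mathcal{A}_G(t))$ with $G(t)=e^{x(e^t-1)}$. -}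

module Defs where

open import Data.Bool.Properties using () renaming (_≟_ to _≟ᵇ_)
open import Data.Fin using (Fin; toℕ)
open import Data.Fin.Properties using (any?; all?; pigeonhole; toℕ≤pred[n]) renaming (_≟_ to _≟ᶠ_)
open import Data.Fin.Subset using (Subset; inside; outside; _∩_; ⋃; Nonempty; Empty)
open import Data.Fin.Subset.Properties using (nonempty?)
open import Data.Integer using (+_)
open import Data.List using (List; []; _∷_; _++_; map; foldr; filter; concatMap; length; replicate; applyUpTo; allFin; cartesianProductWith)
open import Data.List.Relation.Unary.All using (All) renaming (all? to allᴸ?)
open import Data.List.Relation.Unary.AllPairs using (AllPairs; allPairs?)
open import Data.Maybe using (Maybe; just; nothing; fromMaybe)
open import Data.Maybe.Properties using (just-injective) renaming (≡-dec to ≡-decᴹ)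
open import Data.Nat using (ℕ; zero; suc; _+_; _*_; _∸_; _!; _≤_; >-nonZero)
open import Data.Nat.Properties using (_!≢0; m+[n∸m]≡n; <⇒≤; ≤-refl; m≤n+m; m≤m*n; m<n⇒0<n∸m)
open import Data.Product using (∃; _×_; _,_; proj₁; proj₂)
open import Data.Rational using (ℚ; 0ℚ; 1ℚ; _/_) renaming (_+_ to _+ℚ_; _*_ to _*ℚ_; -_ to -ℚ_)
open import Data.Vec using (Vec; []; _∷_; lookup) renaming (map to mapⱽ; tabulate to tabulateⱽ; replicate to replicateⱽ; sum to sumⱽ)
open import Data.Vec.Properties using () renaming (≡-dec to ≡-decⱽ)
open import Relation.Binary.Construct.Closure.ReflexiveTransitive using (Star; ε; _◅_)
open import Relation.Binary.PropositionalEquality using (_≡_; refl; sym; trans; cong; subst; module ≡-Reasoning)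
open import Relation.Nullary using (Dec; yes; no; does; ¬?)
open import Relation.Nullary.Decidable using (_×-dec_; map′)

infixl 6 _+ᴾ_ _-ˢ_
infixl 7 _*ᴾ_ _·ᴾ_ _*ˢ_ _·ˢ_
infixr 8 _^ᴾ_ _^ˢ_
infixr 9 _∘ᴾ_
infix 4 _≈ᴾ_

fromℕ : ℕ → ℚ
fromℕ n = + n / 1

1/_! : ℕ → ℚ
1/ k ! = (+ 1 / (k !)) {{k !≢0}}

-- Coefficients in increasing degree.  Trailing zeros are allowed, so
-- equality of polynomials is _≈ᴾ_ and not _≡_.
Polynomial : Set
Polynomial = List ℚ

coeff : Polynomial → ℕ → ℚ
coeff []      _       = 0ℚ
coeff (a ∷ p) zero    = a
coeff (a ∷ p) (suc k) = coeff p k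

_≈ᴾ_ : Polynomial → Polynomial → Set
p ≈ᴾ q = ∀ k → coeff p k ≡ coeff q k

0ᴾ 1ᴾ X : Polynomial
0ᴾ = []
1ᴾ = 1ℚ ∷ []
X  = 0ℚ ∷ 1ℚ ∷ []

_+ᴾ_ : Polynomial → Polynomial → Polynomial
[]      +ᴾ q       = q
(a ∷ p) +ᴾ []      = a ∷ p
(a ∷ p) +ᴾ (b ∷ q) = (a +ℚ b) ∷ (p +ᴾ q)

_·ᴾ_ : ℚ → Polynomial → Polynomial
c ·ᴾ p = map (c *ℚ_) p

_*ᴾ_ : Polynomial → Polynomial → Polynomial
[]      *ᴾ q = []
(a ∷ p) *ᴾ q = (a ·ᴾ q) +ᴾ (0ℚ ∷ (p *ᴾ q))

_^ᴾ_ : Polynomial → ℕ → Polynomial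
p ^ᴾ zero  = 1ᴾ
p ^ᴾ suc k = p *ᴾ p ^ᴾ k

sumᴾ : List Polynomial → Polynomial
sumᴾ = foldr _+ᴾ_ 0ᴾ

_∘ᴾ_ : Polynomial → Polynomial → Polynomial
[]      ∘ᴾ q = 0ᴾ
(a ∷ p) ∘ᴾ q = (a ∷ []) +ᴾ q *ᴾ (p ∘ᴾ q)

eval : Polynomial → ℚ → ℚ
eval []      c = 0ℚ
eval (a ∷ p) c = a +ℚ c *ℚ eval p c

-- f m is the coefficient of tᵐ (not of tᵐ/m!).
Series : Set
Series = ℕ → Polynomial

1ˢ t : Series
1ˢ zero    = 1ᴾ
1ˢ (suc _) = 0ᴾ
t zero     = 0ᴾ
t (suc m)  = 1ˢ m

_-ˢ_ : Series → Series → Series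
(f -ˢ g) m = f m +ᴾ (-ℚ 1ℚ) ·ᴾ g m

_·ˢ_ : Polynomial → Series → Series
(p ·ˢ f) m = p *ᴾ f m

_*ˢ_ : Series → Series → Series
(f *ˢ g) m = sumᴾ (applyUpTo (λ i → f i *ᴾ g (m ∸ i)) (suc m))

_^ˢ_ : Series → ℕ → Series
f ^ˢ zero  = 1ˢ
f ^ˢ suc k = f *ˢ f ^ˢ k

-- eᶠ = Σₖ fᵏ/k!, for f with zero constant term: then fᵏ does not
-- contribute to the coefficient of tᵐ when k > m, so the sum stops at m.
exp : Series → Series
exp f m = sumᴾ (applyUpTo (λ k → 1/ k ! ·ᴾ (f ^ˢ k) m) (suc m))

touchard : ℕ → Polynomial
touchard m = fromℕ (m !) ·ᴾ exp (X ·ˢ (exp t -ˢ 1ˢ)) m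

-- choices and sublists introduce no repetition when applied to lists without
-- repetition.
choices : ∀ {A : Set} {n} → Vec (List A) n → List (Vec A n)
choices []         = [] ∷ []
choices (xs ∷ xss) = cartesianProductWith _∷_ xs (choices xss)

sublists : ∀ {A : Set} → List A → List (List A)
sublists []       = [] ∷ []
sublists (x ∷ xs) = sublists xs ++ map (x ∷_) (sublists xs)

subsets : ∀ n → List (Subset n)
subsets n = choices (replicateⱽ n (outside ∷ inside ∷ []))

IsSetPartition : ∀ {n} → Subset n → List (Subset n) → Set
IsSetPartition S π =
  All Nonempty π × AllPairs (λ b c → Empty (b ∩ c)) π × ⋃ π ≡ S

isSetPartition? : ∀ {n} (S : Subset n) π → Dec (IsSetPartition S π)
isSetPartition? S π =
  allᴸ? nonempty? π ×-dec
  allPairs? (λ b c → ¬? (nonempty? (b ∩ c))) π ×-dec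
  ≡-decⱽ _≟ᵇ_ (⋃ π) S

-- A set of subsets of Fin n is represented by the sublist of subsets n
-- having the same members, so each set partition is listed exactly once.
setPartitions : ∀ {n} → Subset n → List (List (Subset n))
setPartitions {n} S = filter (isSetPartition? S) (sublists (subsets n))

-- The parent of each vertex, nothing for a root.
ParentMap : ℕ → Set
ParentMap n = Vec (Maybe (Fin n)) n

ChildOf : ∀ {n} → ParentMap n → Fin n → Fin n → Set
ChildOf p v w = lookup p v ≡ just w

IsTreeRootedAt : ∀ {n} → ParentMap n → Fin n → Set
IsTreeRootedAt p r = lookup p r ≡ nothing × (∀ v → Star (ChildOf p) v r)

IsRootedTree : ∀ {n} → ParentMap n → Set
IsRootedTree p = ∃ λ r → IsTreeRootedAt p r

children : ∀ {n} → ParentMap n → Fin n → Subset n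
children p v = mapⱽ (λ q → does (≡-decᴹ _≟ᶠ_ q (just v))) p

-- Deciding IsRootedTree: a vertex lies below the root r exactly when n
-- steps towards the root (staying put at r) lead from it to r.
module _ {n} (p : ParentMap n) where

  climb : ℕ → Fin n → Fin n
  climb zero    v = v
  climb (suc k) v = climb k (fromMaybe v (lookup p v))

  climb-+ : ∀ j k v → climb (j + k) v ≡ climb k (climb j v)
  climb-+ zero    k v = refl
  climb-+ (suc j) k v = climb-+ j k _

  climb⇒star : ∀ k v → Star (ChildOf p) v (climb k v)
  climb⇒star zero    v = ε
  climb⇒star (suc k) v with lookup p v in eq
  ... | nothing = climb⇒star k v
  ... | just w  = eq ◅ climb⇒star k w

  star⇒climb : ∀ {v w} → Star (ChildOf p) v w → ∃ λ k → climb k v ≡ w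
  star⇒climb ε = 0 , refl
  star⇒climb {v} (eq ◅ s) with k , e ← star⇒climb s =
    suc k , trans (cong (λ q → climb k (fromMaybe v q)) eq) e

  climb-periodic : ∀ d k {u} → climb d u ≡ u → climb (k * d) u ≡ u
  climb-periodic d zero    e = refl
  climb-periodic d (suc k) {u} e =
    trans (climb-+ d (k * d) u)
          (trans (cong (climb (k * d)) e) (climb-periodic d k e))

  module _ {r} (root : lookup p r ≡ nothing) where

    climb-root : ∀ k → climb k r ≡ r
    climb-root zero    = refl
    climb-root (suc k) =
      trans (cong (λ q → climb k (fromMaybe r q)) root) (climb-root k)

    climb-mono : ∀ {j k} v → j ≤ k → climb j v ≡ r → climb k v ≡ r
    climb-mono {j} {k} v j≤k e = begin
      climb k v                 ≡⟨ cong (λ m → climb m v) (m+[n∸m]≡n j≤k) ⟨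
      climb (j + (k ∸ j)) v     ≡⟨ climb-+ j (k ∸ j) v ⟩
      climb (k ∸ j) (climb j v) ≡⟨ cong (climb (k ∸ j)) e ⟩
      climb (k ∸ j) r           ≡⟨ climb-root (k ∸ j) ⟩
      r                         ∎
      where open ≡-Reasoning

    climb-bound : ∀ k v → climb k v ≡ r → climb n v ≡ r
    climb-bound k v e
      with i , j , i<j , eᵢⱼ ← pigeonhole ≤-refl (λ (i : Fin (suc n)) → climb (toℕ i) v) =
      climb-mono v (toℕ≤pred[n] i)
        (trans (sym (climb-periodic d k fixed)) (climb-mono u k≤k*d e′))
      where
      open ≡-Reasoning
      d = toℕ j ∸ toℕ i
      u = climb (toℕ i) v
      fixed : climb d u ≡ u
      fixed = begin
        climb d u             ≡⟨ climb-+ (toℕ i) d v ⟨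
        climb (toℕ i + d) v   ≡⟨ cong (λ m → climb m v) (m+[n∸m]≡n (<⇒≤ i<j)) ⟩
        climb (toℕ j) v       ≡⟨ eᵢⱼ ⟨
        u                     ∎
      k≤k*d : k ≤ k * d
      k≤k*d = m≤m*n k d {{>-nonZero (m<n⇒0<n∸m i<j)}}
      e′ : climb k u ≡ r
      e′ = trans (sym (climb-+ (toℕ i) k v)) (climb-mono v (m≤n+m k (toℕ i)) e)

    below-root? : ∀ v → Dec (Star (ChildOf p) v r)
    below-root? v = map′
      (λ e → subst (Star (ChildOf p) v) e (climb⇒star n v))
      (λ s → let k , e = star⇒climb s in climb-bound k v e)
      (climb n v ≟ᶠ r)

  isTreeRootedAt? : ∀ r → Dec (IsTreeRootedAt p r)
  isTreeRootedAt? r with ≡-decᴹ _≟ᶠ_ (lookup p r) nothing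
  ... | no ¬root = no λ h → ¬root (proj₁ h)
  ... | yes root = map′ (root ,_) proj₂ (all? (below-root? root))

  isRootedTree? : Dec (IsRootedTree p)
  isRootedTree? = any? isTreeRootedAt?

rootedTrees : ∀ n → List (ParentMap n)
rootedTrees n =
  filter isRootedTree? (choices (replicateⱽ n (nothing ∷ map just (allFin n))))

-- The second component lists, at v, the blocks of the partition of the
-- children of v.
Enriched : ℕ → Set
Enriched n = ParentMap n × Vec (List (Subset n)) n

enrichedTrees : ∀ n → List (Enriched n)
enrichedTrees n =
  concatMap (λ p → map (p ,_) (choices (tabulateⱽ (λ v → setPartitions (children p v)))))
            (rootedTrees n)

blocks : ∀ {n} → Enriched n → ℕ
blocks (_ , πs) = sumⱽ (mapⱽ length πs)

𝒜 : ℕ → Polynomial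
𝒜 n = sumᴾ (map (λ T → X ^ᴾ blocks T) (enrichedTrees n))

{-# OPTIONS --safe #-}

-- Exponential generating functions are handled through their derivative: T_m(y) is the solution
-- of f′ = y eᵗ f with f(0) = 1, so T_m(y + z) is the binomial convolution of T_m(y) and T_m(z).
-- Splitting off the block of a given element shows that the weights of the set partitions of a
-- k-element set add up to T_k(x).
--
-- To sum over trees, explore a tree from its root.  Suppose that N vertices have unknown children
-- and that u of them also have an unknown parent, and choose a vertex r with known parent and
-- unknown children.  Summing over the set C of the children of r leads to a state with N − 1
-- and u − |C| in place of N and u, whence by induction N F = (N − u) T_u(N x) for the total
-- weight F of the completions.  The inductive step is the addition formula together with
-- N (t f′ g) = t h′ for f = e^{x(eᵗ−1)}, g = e^{(N−1)x(eᵗ−1)} and h = f g.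
-- The initial state has u = N − 1 = n − 1; summing over the n roots gives T_{n−1}(n x).
module Submission where

open import Defs
import Algebra.Properties.Semiring.Exp as Exp
import Algebra.Solver.Ring.NaturalCoefficients.Default as Solver
open import Algebra.Bundles using (CommutativeSemiring; CommutativeRing)
open import Algebra.Morphism.Structures using (module SemiringMorphisms)
open import Data.Bool using (true; false; if_then_else_)
open import Data.Bool.Properties using () renaming (_≟_ to _≟ᵇ_)
open import Data.Empty using (⊥-elim)
open import Data.Fin using (Fin; zero; suc)
open import Data.Fin.Properties using (any?; all?) renaming (_≟_ to _≟ᶠ_)
open import Data.Fin.Subset
  using (Subset; inside; outside; _∈_; _∉_; _⊆_; _∩_; _∪_; _─_; _-_; ∣_∣; ∁; ⁅_⁆; ⊤; ⋃; Nonempty;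
         Empty)
  renaming (⊥ to ∅)
open import Data.Fin.Subset.Properties
  using (_∈?_; _⊆?_; nonempty?; out⊆; in⊆in; drop-∷-⊆; drop-there; ∉⊥; ∈⊤; ⊆-antisym; p─q⊆p; p⊆p∪q;
         q⊆p∪q; x∈p∪q⁻; x∈p∩q⁺; x∈p∩q⁻; x∈p∧x∉q⇒x∈p─q; x∈p∧x≢y⇒x∈p-y; p─⊥≡p; p─q─r≡p─r─q;
           p∩q≢∅⇒∣p─q∣<∣p∣;
         x∈∁p⇒x∉p; x∉∁p⇒x∈p; x∈p⇒x∉∁p; x∈⁅x⁆; x∈⁅y⁆⇒x≡y; ∣⁅x⁆∣≡1; ∣⊤∣≡n; ∣∁p∣≡n∸∣p∣)
import Data.Integer as ℤ
import Data.Integer.Properties as ℤ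
open import Data.List
  using (List; []; _∷_; _++_; map; foldr; filter; concatMap; cartesianProductWith; length; allFin;
         applyUpTo)
open import Data.List.Properties using (map-tabulate; length-tabulate)
open import Data.List.Relation.Unary.All using (All; []; _∷_)
open import Data.List.Relation.Unary.AllPairs using ([]; _∷_)
open import Data.Maybe using (Maybe; just; nothing)
open import Data.Maybe.Properties using (just-injective) renaming (≡-dec to ≡-decᴹ)
open import Data.Nat using (ℕ; zero; suc; _∸_; _!; _≤_; _<_; _≥_; z≤n; s≤s; NonZero)
import Data.Nat as ℕ
import Data.Nat.Properties as ℕ
open import Data.Product using (∃; _×_; _,_; proj₁; proj₂)
open import Data.Rational using (ℚ; 0ℚ; 1ℚ; _/_; toℚᵘ)
import Data.Rational as ℚ
import Data.Rational.Properties as ℚ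
open import Data.Rational.Solver using (module +-*-Solver)
open import Data.Rational.Unnormalised using (mkℚᵘ; *≡*)
import Data.Rational.Unnormalised as ℚᵘ
import Data.Rational.Unnormalised.Properties as ℚᵘ
open import Data.Sum using (inj₁; inj₂)
open import Data.Vec
  using (Vec; []; _∷_; lookup; replicate; here; there)
  renaming (map to mapⱽ; sum to sumⱽ; tabulate to tabulateⱽ)
open import Data.Vec.Properties
  using (lookup-map; lookup-replicate; lookup∘tabulate; tabulate∘lookup; tabulate-cong; []=⇒lookup;
         lookup⇒[]=)
  renaming (≡-dec to ≡-decⱽ)
open import Function using (_∘_; id)
open import Level using (0ℓ)
open import Relation.Binary.Bundles using (Setoid)
open import Relation.Binary.Construct.Closure.ReflexiveTransitive using (Star; ε; _◅_)
open import Relation.Binary.PropositionalEquality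
  using (_≡_; _≢_; cong; cong₂; subst; module ≡-Reasoning)
  renaming (refl to ≡-refl; sym to ≡-sym; trans to ≡-trans)
import Relation.Binary.Reasoning.Setoid as SetoidReasoning
open import Relation.Nullary using (Dec; yes; no; does; ¬_; ¬?; contradiction)
open import Relation.Nullary.Decidable using (_×-dec_; _→-dec_; dec-true)
open import Relation.Unary using (Pred; Decidable)

module _ where

  open import Data.Integer using (+_)
  open import Data.Rational using (_+_; _*_)
  open import Data.Rational.Properties
    using (toℚᵘ-injective; toℚᵘ-homo-+; toℚᵘ-homo-*; toℚᵘ-fromℚᵘ; +-*-commutativeRing; +-comm;
           +-assoc; +-identityˡ; +-identityʳ; *-comm; *-assoc; *-identityˡ; *-zeroʳ; *-zeroˡ;
             *-distribˡ-+)
  open import Relation.Binary.PropositionalEquality using (refl; sym; trans)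

  fromℕ-+ : ∀ m n → fromℕ (m ℕ.+ n) ≡ fromℕ m + fromℕ n
  fromℕ-+ m n = toℚᵘ-injective (begin
    toℚᵘ (fromℕ (m ℕ.+ n))                      ≈⟨ toℚᵘ-fromℚᵘ (mkℚᵘ (+ (m ℕ.+ n)) 0) ⟩
    mkℚᵘ (+ (m ℕ.+ n)) 0
      ≈⟨ *≡* (cong₂ (λ a b → + (a ℕ.+ b) ℤ.* + 1) (sym (ℕ.*-identityʳ m)) (sym (ℕ.*-identityʳ n))) ⟩
    mkℚᵘ (+ (m ℕ.* 1 ℕ.+ n ℕ.* 1)) 0
      ≈⟨ *≡* (cong (ℤ._* + 1) (cong₂ ℤ._+_ (ℤ.pos-* m 1) (ℤ.pos-* n 1))) ⟩
    mkℚᵘ (+ m) 0 ℚᵘ.+ mkℚᵘ (+ n) 0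
      ≈⟨ ℚᵘ.+-cong (toℚᵘ-fromℚᵘ (mkℚᵘ (+ m) 0)) (toℚᵘ-fromℚᵘ (mkℚᵘ (+ n) 0)) ⟨
    toℚᵘ (fromℕ m) ℚᵘ.+ toℚᵘ (fromℕ n)          ≈⟨ toℚᵘ-homo-+ (fromℕ m) (fromℕ n) ⟨
    toℚᵘ (fromℕ m + fromℕ n)                    ∎)
    where
    open SetoidReasoning ℚᵘ.≃-setoid

  1/ℕ : ∀ n .{{_ : ℕ.NonZero n}} → ℚ
  1/ℕ n = + 1 / n

  1/n*n≡1 : ∀ n .{{_ : ℕ.NonZero n}} → 1/ℕ n * fromℕ n ≡ 1ℚ
  1/n*n≡1 n@(suc n-1) = toℚᵘ-injective (begin
    toℚᵘ (1/ℕ n * fromℕ n)                  ≈⟨ toℚᵘ-homo-* (1/ℕ n) (fromℕ n) ⟩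
    toℚᵘ (1/ℕ n) ℚᵘ.* toℚᵘ (fromℕ n)
      ≈⟨ ℚᵘ.*-cong (toℚᵘ-fromℚᵘ (mkℚᵘ (+ 1) n-1)) (toℚᵘ-fromℚᵘ (mkℚᵘ (+ n) 0)) ⟩
    mkℚᵘ (+ 1) n-1 ℚᵘ.* mkℚᵘ (+ n) 0
      ≈⟨ *≡* (trans (ℤ.*-identityʳ (+ 1 ℤ.* + n)) (cong (λ a → + 1 ℤ.* + a) (sym (ℕ.*-identityʳ n)))) ⟩
    toℚᵘ 1ℚ                                     ∎)
    where
    open SetoidReasoning ℚᵘ.≃-setoid

  -- Unlike _≈ᴾ_, which unfolds, this relation determines its two sides.
  record _≋_ (p q : Polynomial) : Set where
    constructor mk≋
    field at : p ≈ᴾ q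
  open _≋_ public

  infix 4 _≋_

  ≋-refl : ∀ {p} → p ≋ p
  ≋-refl .at k = refl

  ≋-sym : ∀ {p q} → p ≋ q → q ≋ p
  ≋-sym e .at k = sym (e .at k)

  ≋-trans : ∀ {p q r} → p ≋ q → q ≋ r → p ≋ r
  ≋-trans e f .at k = trans (e .at k) (f .at k)

  ∷-cong : ∀ {a b p q} → a ≡ b → p ≋ q → a ∷ p ≋ b ∷ q
  ∷-cong a≡b p≋q .at zero    = a≡b
  ∷-cong a≡b p≋q .at (suc k) = p≋q .at k

  0∷[]≋[] : 0ℚ ∷ [] ≋ []
  0∷[]≋[] .at zero    = refl
  0∷[]≋[] .at (suc k) = refl

  coeff-+ : ∀ p q k → coeff (p +ᴾ q) k ≡ coeff p k + coeff q k
  coeff-+ []      q       k       = sym (+-identityˡ (coeff q k))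
  coeff-+ (a ∷ p) []      k       = sym (+-identityʳ (coeff (a ∷ p) k))
  coeff-+ (a ∷ p) (b ∷ q) zero    = refl
  coeff-+ (a ∷ p) (b ∷ q) (suc k) = coeff-+ p q k

  coeff-· : ∀ c p k → coeff (c ·ᴾ p) k ≡ c * coeff p k
  coeff-· c []      k       = sym (*-zeroʳ c)
  coeff-· c (a ∷ p) zero    = refl
  coeff-· c (a ∷ p) (suc k) = coeff-· c p k

  +ᴾ-cong : ∀ {p p′ q q′} → p ≋ p′ → q ≋ q′ → p +ᴾ q ≋ p′ +ᴾ q′
  +ᴾ-cong {p} {p′} {q} {q′} e f .at k = begin
    coeff (p +ᴾ q) k         ≡⟨ coeff-+ p q k ⟩
    coeff p k + coeff q k    ≡⟨ cong₂ _+_ (e .at k) (f .at k) ⟩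
    coeff p′ k + coeff q′ k  ≡⟨ coeff-+ p′ q′ k ⟨
    coeff (p′ +ᴾ q′) k       ∎
    where open ≡-Reasoning

  +ᴾ-comm : ∀ p q → p +ᴾ q ≋ q +ᴾ p
  +ᴾ-comm p q .at k = trans (coeff-+ p q k)
    (trans (+-comm (coeff p k) (coeff q k)) (sym (coeff-+ q p k)))

  +ᴾ-assoc : ∀ p q r → (p +ᴾ q) +ᴾ r ≋ p +ᴾ (q +ᴾ r)
  +ᴾ-assoc p q r .at k = begin
    coeff (p +ᴾ q +ᴾ r) k                 ≡⟨ coeff-+ (p +ᴾ q) r k ⟩
    coeff (p +ᴾ q) k + coeff r k          ≡⟨ cong (_+ coeff r k) (coeff-+ p q k) ⟩
    coeff p k + coeff q k + coeff r k     ≡⟨ +-assoc (coeff p k) (coeff q k) (coeff r k) ⟩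
    coeff p k + (coeff q k + coeff r k)   ≡⟨ cong (λ a → coeff p k + a) (coeff-+ q r k) ⟨
    coeff p k + coeff (q +ᴾ r) k          ≡⟨ coeff-+ p (q +ᴾ r) k ⟨
    coeff (p +ᴾ (q +ᴾ r)) k               ∎
    where open ≡-Reasoning

  +ᴾ-identityʳ : ∀ p → p +ᴾ [] ≋ p
  +ᴾ-identityʳ p = +ᴾ-comm p []

  +ᴾ-interchange : ∀ p q r s → (p +ᴾ q) +ᴾ (r +ᴾ s) ≋ (p +ᴾ r) +ᴾ (q +ᴾ s)
  +ᴾ-interchange p q r s .at k
    rewrite coeff-+ (p +ᴾ q) (r +ᴾ s) k | coeff-+ p q k | coeff-+ r s k
          | coeff-+ (p +ᴾ r) (q +ᴾ s) k | coeff-+ p r k | coeff-+ q s k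
    = solve 4 (λ a b c d → (a :+ b) :+ (c :+ d) := (a :+ c) :+ (b :+ d)) refl (coeff p k) (coeff q k)
      (coeff r k) (coeff s k)
    where open +-*-Solver

  ·ᴾ-cong : ∀ c {p q} → p ≋ q → c ·ᴾ p ≋ c ·ᴾ q
  ·ᴾ-cong c {p} {q} e .at k = trans (coeff-· c p k)
    (trans (cong (c *_) (e .at k)) (sym (coeff-· c q k)))

  ·ᴾ-distrib-+ᴾ : ∀ c p q → c ·ᴾ (p +ᴾ q) ≋ c ·ᴾ p +ᴾ c ·ᴾ q
  ·ᴾ-distrib-+ᴾ c p q .at k
    rewrite coeff-· c (p +ᴾ q) k | coeff-+ p q k | coeff-+ (c ·ᴾ p)
      (c ·ᴾ q) k | coeff-· c p k | coeff-· c q k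
    = *-distribˡ-+ c (coeff p k) (coeff q k)

  ·ᴾ-assoc : ∀ c d p → c ·ᴾ (d ·ᴾ p) ≋ (c * d) ·ᴾ p
  ·ᴾ-assoc c d p .at k
    rewrite coeff-· c (d ·ᴾ p) k | coeff-· d p k | coeff-· (c * d) p k
    = sym (*-assoc c d (coeff p k))

  1·ᴾ : ∀ p → 1ℚ ·ᴾ p ≋ p
  1·ᴾ p .at k = trans (coeff-· 1ℚ p k) (*-identityˡ (coeff p k))

  0·ᴾ : ∀ p → 0ℚ ·ᴾ p ≋ []
  0·ᴾ p .at k = trans (coeff-· 0ℚ p k) (*-zeroˡ (coeff p k))

  ≋-setoid : Setoid 0ℓ 0ℓ
  ≋-setoid = record
    { Carrier = Polynomial
    ; _≈_ = _≋_
    ; isEquivalence = record { refl = ≋-refl ; sym = ≋-sym ; trans = ≋-trans } }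

  private module ≋-Reasoning = SetoidReasoning ≋-setoid

  *ᴾ-congʳ : ∀ p {q q′} → q ≋ q′ → p *ᴾ q ≋ p *ᴾ q′
  *ᴾ-congʳ []      e = ≋-refl
  *ᴾ-congʳ (a ∷ p) e = +ᴾ-cong (·ᴾ-cong a e) (∷-cong refl (*ᴾ-congʳ p e))

  *ᴾ-zeroʳ : ∀ p → p *ᴾ [] ≋ []
  *ᴾ-zeroʳ []      = ≋-refl
  *ᴾ-zeroʳ (a ∷ p) = ≋-trans (∷-cong refl (*ᴾ-zeroʳ p)) 0∷[]≋[]

  *ᴾ-∷ : ∀ p b q → p *ᴾ (b ∷ q) ≋ b ·ᴾ p +ᴾ (0ℚ ∷ p *ᴾ q)
  *ᴾ-∷ []      b q = ≋-sym 0∷[]≋[]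
  *ᴾ-∷ (a ∷ p) b q = ∷-cong (cong (_+ 0ℚ) (*-comm a b)) (begin
    a ·ᴾ q +ᴾ p *ᴾ (b ∷ q)                ≈⟨ +ᴾ-cong (≋-refl {a ·ᴾ q}) (*ᴾ-∷ p b q) ⟩
    a ·ᴾ q +ᴾ (b ·ᴾ p +ᴾ (0ℚ ∷ p *ᴾ q))   ≈⟨ +ᴾ-interchange [] (a ·ᴾ q) (b ·ᴾ p) _ ⟩
    b ·ᴾ p +ᴾ (a ·ᴾ q +ᴾ (0ℚ ∷ p *ᴾ q))   ∎)
    where open ≋-Reasoning

  *ᴾ-comm : ∀ p q → p *ᴾ q ≋ q *ᴾ p
  *ᴾ-comm []      q = ≋-sym (*ᴾ-zeroʳ q)
  *ᴾ-comm (a ∷ p) q = begin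
    a ·ᴾ q +ᴾ (0ℚ ∷ p *ᴾ q)  ≈⟨ +ᴾ-cong (≋-refl {a ·ᴾ q}) (∷-cong refl (*ᴾ-comm p q)) ⟩
    a ·ᴾ q +ᴾ (0ℚ ∷ q *ᴾ p)  ≈⟨ *ᴾ-∷ q a p ⟨
    q *ᴾ (a ∷ p)             ∎
    where open ≋-Reasoning

  *ᴾ-cong : ∀ {p p′ q q′} → p ≋ p′ → q ≋ q′ → p *ᴾ q ≋ p′ *ᴾ q′
  *ᴾ-cong {p} {p′} {q} {q′} e f = begin
    p *ᴾ q    ≈⟨ *ᴾ-congʳ p f ⟩
    p *ᴾ q′   ≈⟨ *ᴾ-comm p q′ ⟩
    q′ *ᴾ p   ≈⟨ *ᴾ-congʳ q′ e ⟩
    q′ *ᴾ p′  ≈⟨ *ᴾ-comm q′ p′ ⟩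
    p′ *ᴾ q′  ∎
    where open ≋-Reasoning

  *ᴾ-distribˡ : ∀ p q r → p *ᴾ (q +ᴾ r) ≋ p *ᴾ q +ᴾ p *ᴾ r
  *ᴾ-distribˡ []      q r = ≋-refl
  *ᴾ-distribˡ (a ∷ p) q r = begin
    a ·ᴾ (q +ᴾ r) +ᴾ (0ℚ ∷ p *ᴾ (q +ᴾ r))
      ≈⟨ +ᴾ-cong (·ᴾ-distrib-+ᴾ a q r) (∷-cong refl (*ᴾ-distribˡ p q r)) ⟩
    (a ·ᴾ q +ᴾ a ·ᴾ r) +ᴾ ((0ℚ ∷ p *ᴾ q) +ᴾ (0ℚ ∷ p *ᴾ r))        ≈⟨ +ᴾ-interchange (a ·ᴾ q)
      (a ·ᴾ r) _ _ ⟩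
    (a ·ᴾ q +ᴾ (0ℚ ∷ p *ᴾ q)) +ᴾ (a ·ᴾ r +ᴾ (0ℚ ∷ p *ᴾ r))        ∎
    where open ≋-Reasoning

  *ᴾ-distribʳ : ∀ r p q → (p +ᴾ q) *ᴾ r ≋ p *ᴾ r +ᴾ q *ᴾ r
  *ᴾ-distribʳ r p q = begin
    (p +ᴾ q) *ᴾ r       ≈⟨ *ᴾ-comm (p +ᴾ q) r ⟩
    r *ᴾ (p +ᴾ q)       ≈⟨ *ᴾ-distribˡ r p q ⟩
    r *ᴾ p +ᴾ r *ᴾ q    ≈⟨ +ᴾ-cong (*ᴾ-comm r p) (*ᴾ-comm r q) ⟩
    p *ᴾ r +ᴾ q *ᴾ r    ∎
    where open ≋-Reasoning

  ·ᴾ-*ᴾ : ∀ c p q → (c ·ᴾ p) *ᴾ q ≋ c ·ᴾ (p *ᴾ q)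
  ·ᴾ-*ᴾ c []      q = ≋-refl
  ·ᴾ-*ᴾ c (a ∷ p) q = begin
    (c * a) ·ᴾ q +ᴾ (0ℚ ∷ (c ·ᴾ p) *ᴾ q)
      ≈⟨ +ᴾ-cong (≋-sym (·ᴾ-assoc c a q)) (∷-cong (sym (*-zeroʳ c)) (·ᴾ-*ᴾ c p q)) ⟩
    c ·ᴾ (a ·ᴾ q) +ᴾ c ·ᴾ (0ℚ ∷ p *ᴾ q)        ≈⟨ ·ᴾ-distrib-+ᴾ c (a ·ᴾ q) _ ⟨
    c ·ᴾ (a ·ᴾ q +ᴾ (0ℚ ∷ p *ᴾ q))             ∎
    where open ≋-Reasoning

  *ᴾ-assoc : ∀ p q r → (p *ᴾ q) *ᴾ r ≋ p *ᴾ (q *ᴾ r)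
  *ᴾ-assoc []      q r = ≋-refl
  *ᴾ-assoc (a ∷ p) q r = begin
    (a ·ᴾ q +ᴾ (0ℚ ∷ p *ᴾ q)) *ᴾ r                 ≈⟨ *ᴾ-distribʳ r (a ·ᴾ q) _ ⟩
    (a ·ᴾ q) *ᴾ r +ᴾ (0ℚ ·ᴾ r +ᴾ (0ℚ ∷ (p *ᴾ q) *ᴾ r))
      ≈⟨ +ᴾ-cong (·ᴾ-*ᴾ a q r) (+ᴾ-cong (0·ᴾ r) (∷-cong refl (*ᴾ-assoc p q r))) ⟩
    a ·ᴾ (q *ᴾ r) +ᴾ (0ℚ ∷ p *ᴾ (q *ᴾ r))          ∎
    where open ≋-Reasoning

  ·ᴾ≋*ᴾ : ∀ c p → c ·ᴾ p ≋ (c ∷ []) *ᴾ p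
  ·ᴾ≋*ᴾ c p = ≋-trans (≋-sym (+ᴾ-identityʳ (c ·ᴾ p))) (+ᴾ-cong (≋-refl {c ·ᴾ p}) (≋-sym 0∷[]≋[]))

  *ᴾ-identityˡ : ∀ p → 1ᴾ *ᴾ p ≋ p
  *ᴾ-identityˡ p = ≋-trans (≋-sym (·ᴾ≋*ᴾ 1ℚ p)) (1·ᴾ p)

  polynomialSemiring : CommutativeSemiring 0ℓ 0ℓ
  polynomialSemiring = record
    { Carrier = Polynomial ; _≈_ = _≋_ ; _+_ = _+ᴾ_ ; _*_ = _*ᴾ_ ; 0# = 0ᴾ ; 1# = 1ᴾ
    ; isCommutativeSemiring = record
      { isSemiring = record
        { isSemiringWithoutAnnihilatingZero = record
          { +-isCommutativeMonoid = record
            { isMonoid = record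
              { isSemigroup = record
                { isMagma = record
                  { isEquivalence = Setoid.isEquivalence ≋-setoid
                  ; ∙-cong = +ᴾ-cong }
                ; assoc = +ᴾ-assoc }
              ; identity = (λ p → ≋-refl) , +ᴾ-identityʳ }
            ; comm = +ᴾ-comm }
          ; *-cong = *ᴾ-cong
          ; *-assoc = *ᴾ-assoc
          ; *-identity = *ᴾ-identityˡ , (λ p → ≋-trans (*ᴾ-comm p 1ᴾ) (*ᴾ-identityˡ p))
          ; distrib = *ᴾ-distribˡ , *ᴾ-distribʳ }
        ; zero = (λ p → ≋-refl) , *ᴾ-zeroʳ }
      ; *-comm = *ᴾ-comm } }

  ℚ-semiring : CommutativeSemiring 0ℓ 0ℓ
  ℚ-semiring = CommutativeRing.commutativeSemiring +-*-commutativeRing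

  record ℚ-Algebra : Set₁ where
    field
      commutativeSemiring : CommutativeSemiring 0ℓ 0ℓ
    open CommutativeSemiring commutativeSemiring public hiding (zero)
    open SemiringMorphisms (CommutativeSemiring.rawSemiring ℚ-semiring) rawSemiring public
    field
      ι      : ℚ → Carrier
      ι-homo : IsSemiringHomomorphism ι

  polynomialAlgebra : ℚ-Algebra
  polynomialAlgebra = record
    { commutativeSemiring = polynomialSemiring
    ; ι = _∷ []
    ; ι-homo = record
      { isNearSemiringHomomorphism = record
        { +-isMonoidHomomorphism = record
          { isMagmaHomomorphism = record
            { isRelHomomorphism = record { cong = λ { refl → ≋-refl } }
            ; homo = λ a b → ≋-refl }
          ; ε-homo = 0∷[]≋[] }
        ; *-homo = λ a b → ·ᴾ≋*ᴾ a (b ∷ []) }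
      ; 1#-homo = ≋-refl } }

  rationalAlgebra : ℚ-Algebra
  rationalAlgebra = record
    { commutativeSemiring = ℚ-semiring
    ; ι = λ a → a
    ; ι-homo = record
      { isNearSemiringHomomorphism = record
        { +-isMonoidHomomorphism = record
          { isMagmaHomomorphism = record
            { isRelHomomorphism = record { cong = λ e → e }
            ; homo = λ a b → refl }
          ; ε-homo = refl }
        ; *-homo = λ a b → refl }
      ; 1#-homo = refl } }

module Sums (𝔸 : ℚ-Algebra) where

  open ℚ-Algebra 𝔸 public
  open IsSemiringHomomorphism ι-homo public using () renaming
    (⟦⟧-cong to ι-cong; +-homo to ι-+; *-homo to ι-*; 1#-homo to ι-1; 0#-homo to ι-0)
  open Exp semiring public using (_^_)
  open SetoidReasoning setoid public
  open Solver commutativeSemiring public using (solve; _:=_; _:+_; _:*_; con)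

  ν : ℕ → Carrier
  ν n = ι (fromℕ n)

  ν-+ : ∀ m n → ν (m ℕ.+ n) ≈ ν m + ν n
  ν-+ m n = trans (ι-cong (fromℕ-+ m n)) (ι-+ (fromℕ m) (fromℕ n))

  ν-suc : ∀ n → ν (suc n) ≈ 1# + ν n
  ν-suc n = trans (ν-+ 1 n) (+-congʳ ι-1)

  ν-cancelˡ : ∀ n .{{_ : NonZero n}} {a b} → ν n * a ≈ ν n * b → a ≈ b
  ν-cancelˡ n {a} {b} e = begin
    a                ≈⟨ unit a ⟨
    c * (ν n * a)    ≈⟨ *-congˡ e ⟩
    c * (ν n * b)    ≈⟨ unit b ⟩
    b                ∎
    where
    c = ι (1/ℕ n)
    unit : ∀ a → c * (ν n * a) ≈ a
    unit a = begin
      c * (ν n * a)               ≈⟨ *-assoc c (ν n) a ⟨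
      c * ν n * a                 ≈⟨ *-congʳ (ι-* (1/ℕ n) (fromℕ n)) ⟨
      ι (1/ℕ n ℚ.* fromℕ n) * a ≈⟨ *-congʳ (ι-cong (1/n*n≡1 n)) ⟩
      ι 1ℚ * a                    ≈⟨ *-congʳ ι-1 ⟩
      1# * a                      ≈⟨ *-identityˡ a ⟩
      a                           ∎

  ⟦_⟧ : ∀ {P : Set} → Dec P → Carrier
  ⟦ P? ⟧ = if does P? then 1# else 0#

  ⟦⟧-cong : ∀ {P Q : Set} (P? : Dec P) (Q? : Dec Q) → (P → Q) → (Q → P) → ⟦ P? ⟧ ≈ ⟦ Q? ⟧
  ⟦⟧-cong (yes _) (yes _) _ _ = refl
  ⟦⟧-cong (yes p) (no ¬q) f _ = contradiction (f p) ¬q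
  ⟦⟧-cong (no ¬p) (yes q) _ g = contradiction (g q) ¬p
  ⟦⟧-cong (no _)  (no _)  _ _ = refl

  ⟦⟧-true : ∀ {P : Set} (P? : Dec P) → P → ⟦ P? ⟧ ≈ 1#
  ⟦⟧-true (yes _) _ = refl
  ⟦⟧-true (no ¬p) p = contradiction p ¬p

  ⟦⟧-false : ∀ {P : Set} (P? : Dec P) → ¬ P → ⟦ P? ⟧ ≈ 0#
  ⟦⟧-false (yes p) ¬p = contradiction p ¬p
  ⟦⟧-false (no _)  _  = refl

  ⟦⟧-vanish : ∀ {P : Set} (P? : Dec P) → ¬ P → ∀ {a} → ⟦ P? ⟧ * a ≈ 0#
  ⟦⟧-vanish P? ¬p = trans (*-congʳ (⟦⟧-false P? ¬p)) (zeroˡ _)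

  ⟦⟧-× : ∀ {P Q : Set} (P? : Dec P) (Q? : Dec Q) → ⟦ P? ×-dec Q? ⟧ ≈ ⟦ P? ⟧ * ⟦ Q? ⟧
  ⟦⟧-× (yes _) (yes _) = sym (*-identityˡ 1#)
  ⟦⟧-× (yes _) (no _)  = sym (*-identityˡ 0#)
  ⟦⟧-× (no _)  Q?      = sym (zeroˡ _)

  ⟦⟧-guard : ∀ {P : Set} (P? : Dec P) {a b} → (P → a ≈ b) → ⟦ P? ⟧ * a ≈ ⟦ P? ⟧ * b
  ⟦⟧-guard (yes p) e = *-congˡ (e p)
  ⟦⟧-guard (no _)  e = trans (zeroˡ _) (sym (zeroˡ _))

  Σ : ∀ {A : Set} → List A → (A → Carrier) → Carrier
  Σ xs f = foldr _+_ 0# (map f xs)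

  Σ-cong : ∀ {A : Set} (xs : List A) {f g : A → Carrier} → (∀ x → f x ≈ g x) → Σ xs f ≈ Σ xs g
  Σ-cong []       e = refl
  Σ-cong (x ∷ xs) e = +-cong (e x) (Σ-cong xs e)

  Σ-zero : ∀ {A : Set} (xs : List A) {f : A → Carrier} → (∀ x → f x ≈ 0#) → Σ xs f ≈ 0#
  Σ-zero []       e = refl
  Σ-zero (x ∷ xs) e = trans (+-cong (e x) (Σ-zero xs e)) (+-identityˡ 0#)

  Σ-+ : ∀ {A : Set} (xs : List A) (f g : A → Carrier) → Σ xs (λ x → f x + g x) ≈ Σ xs f + Σ xs g
  Σ-+ []       f g = sym (+-identityˡ 0#)
  Σ-+ (x ∷ xs) f g = begin
    f x + g x + Σ xs (λ x → f x + g x)  ≈⟨ +-congˡ (Σ-+ xs f g) ⟩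
    f x + g x + (Σ xs f + Σ xs g)
      ≈⟨ solve 4 (λ a b c d → (a :+ b) :+ (c :+ d) := (a :+ c) :+ (b :+ d)) refl (f x) (g x) (Σ xs f)
        (Σ xs g) ⟩
    f x + Σ xs f + (g x + Σ xs g)       ∎

  Σ-*ˡ : ∀ {A : Set} c (xs : List A) (f : A → Carrier) → Σ xs (λ x → c * f x) ≈ c * Σ xs f
  Σ-*ˡ c []       f = sym (zeroʳ c)
  Σ-*ˡ c (x ∷ xs) f = trans (+-congˡ (Σ-*ˡ c xs f)) (sym (distribˡ c (f x) (Σ xs f)))

  Σ-*ʳ : ∀ {A : Set} c (xs : List A) (f : A → Carrier) → Σ xs (λ x → f x * c) ≈ Σ xs f * c
  Σ-*ʳ c xs f = trans (Σ-cong xs (λ x → *-comm (f x) c)) (trans (Σ-*ˡ c xs f) (*-comm c (Σ xs f)))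

  Σ-++ : ∀ {A : Set} (xs ys : List A) (f : A → Carrier) → Σ (xs ++ ys) f ≈ Σ xs f + Σ ys f
  Σ-++ []       ys f = sym (+-identityˡ (Σ ys f))
  Σ-++ (x ∷ xs) ys f = trans (+-congˡ (Σ-++ xs ys f)) (sym (+-assoc (f x) (Σ xs f) (Σ ys f)))

  Σ-map : ∀ {A B : Set} (h : A → B) (xs : List A) (f : B → Carrier) → Σ (map h xs) f ≈ Σ xs (f ∘ h)
  Σ-map h []       f = refl
  Σ-map h (x ∷ xs) f = +-congˡ (Σ-map h xs f)

  Σ-concatMap : ∀ {A B : Set} (h : A → List B) (xs : List A) (f : B → Carrier) →
                Σ (concatMap h xs) f ≈ Σ xs (λ x → Σ (h x) f)
  Σ-concatMap h []       f = refl
  Σ-concatMap h (x ∷ xs) f = trans (Σ-++ (h x) (concatMap h xs) f) (+-congˡ (Σ-concatMap h xs f))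

  Σ-swap : ∀ {A B : Set} (xs : List A) (ys : List B) (f : A → B → Carrier) →
           Σ xs (λ x → Σ ys (f x)) ≈ Σ ys (λ y → Σ xs (λ x → f x y))
  Σ-swap []       ys f = sym (Σ-zero ys (λ _ → refl))
  Σ-swap (x ∷ xs) ys f = trans (+-congˡ (Σ-swap xs ys f))
    (sym (Σ-+ ys (f x) (λ y → Σ xs (λ x → f x y))))

  Σ-filter : ∀ {A : Set} {P : Pred A 0ℓ} (P? : Decidable P) (xs : List A) (f : A → Carrier) →
             Σ (filter P? xs) f ≈ Σ xs (λ x → ⟦ P? x ⟧ * f x)
  Σ-filter P? []       f = refl
  Σ-filter P? (x ∷ xs) f with does (P? x)
  ... | true  = +-cong (sym (*-identityˡ (f x))) (Σ-filter P? xs f)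
  ... | false = trans (Σ-filter P? xs f) (sym (trans (+-congʳ (zeroˡ (f x))) (+-identityˡ _)))

  Σ-cartesianProductWith : ∀ {A B C : Set} (h : A → B → C) xs ys (f : C → Carrier) →
    Σ (cartesianProductWith h xs ys) f ≈ Σ xs (λ x → Σ ys (λ y → f (h x y)))
  Σ-cartesianProductWith h []       ys f = refl
  Σ-cartesianProductWith h (x ∷ xs) ys f =
    trans (Σ-++ (map (h x) ys) (cartesianProductWith h xs ys) f)
          (+-cong (Σ-map (h x) ys f) (Σ-cartesianProductWith h xs ys f))

  Σ-choices-≡ : ∀ {A : Set} {n} (_≟_ : (a b : A) → Dec (a ≡ b))
    (_≟ⱽ_ : ∀ {n} (u v : Vec A n) → Dec (u ≡ v))
    (xss : Vec (List A) n) (v : Vec A n) →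
    (∀ i → Σ (lookup xss i) (λ a → ⟦ a ≟ lookup v i ⟧) ≈ 1#) →
    Σ (choices xss) (λ u → ⟦ u ≟ⱽ v ⟧) ≈ 1#
  Σ-choices-≡ _≟_ _≟ⱽ_ []         []      once = trans (+-identityʳ _) (⟦⟧-true ([] ≟ⱽ []) ≡-refl)
  Σ-choices-≡ _≟_ _≟ⱽ_ (xs ∷ xss) (b ∷ v) once = begin
    Σ (choices (xs ∷ xss)) (λ u → ⟦ u ≟ⱽ (b ∷ v) ⟧)
      ≈⟨ Σ-cartesianProductWith _∷_ xs (choices xss) _ ⟩
    Σ xs (λ a → Σ (choices xss) (λ u → ⟦ (a ∷ u) ≟ⱽ (b ∷ v) ⟧))
      ≈⟨ Σ-cong xs (λ a → Σ-cong (choices xss) (λ u → split a u)) ⟩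
    Σ xs (λ a → Σ (choices xss) (λ u → ⟦ a ≟ b ⟧ * ⟦ u ≟ⱽ v ⟧))
      ≈⟨ Σ-cong xs (λ a → Σ-*ˡ ⟦ a ≟ b ⟧ (choices xss) _) ⟩
    Σ xs (λ a → ⟦ a ≟ b ⟧ * Σ (choices xss) (λ u → ⟦ u ≟ⱽ v ⟧))
      ≈⟨ Σ-cong xs (λ a → trans (*-congˡ (Σ-choices-≡ _≟_ _≟ⱽ_ xss v (once ∘ suc))) (*-identityʳ _)) ⟩
    Σ xs (λ a → ⟦ a ≟ b ⟧)                                        ≈⟨ once zero ⟩
    1#                                                           ∎
    where
    split : ∀ a u → ⟦ (a ∷ u) ≟ⱽ (b ∷ v) ⟧ ≈ ⟦ a ≟ b ⟧ * ⟦ u ≟ⱽ v ⟧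
    split a u = trans (⟦⟧-cong ((a ∷ u) ≟ⱽ (b ∷ v)) ((a ≟ b) ×-dec (u ≟ⱽ v))
                         (λ { ≡-refl → ≡-refl , ≡-refl }) (λ { (≡-refl , ≡-refl) → ≡-refl }))
                      (⟦⟧-× (a ≟ b) (u ≟ⱽ v))

  Π : ∀ {n} → (Fin n → Carrier) → Carrier
  Π {zero}  f = 1#
  Π {suc n} f = f zero * Π (f ∘ suc)

  Π-cong : ∀ {n} {f g : Fin n → Carrier} → (∀ i → f i ≈ g i) → Π f ≈ Π g
  Π-cong {zero}  e = refl
  Π-cong {suc n} e = *-cong (e zero) (Π-cong (e ∘ suc))

  Π-one : ∀ {n} {f : Fin n → Carrier} → (∀ i → f i ≈ 1#) → Π f ≈ 1#
  Π-one {zero}  e = refl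
  Π-one {suc n} e = trans (*-cong (e zero) (Π-one (e ∘ suc))) (*-identityˡ 1#)

  ^-+ : ∀ x m n → x ^ (m ℕ.+ n) ≈ x ^ m * x ^ n
  ^-+ x zero    n = sym (*-identityˡ (x ^ n))
  ^-+ x (suc m) n = trans (*-congˡ (^-+ x m n)) (sym (*-assoc x (x ^ m) (x ^ n)))

  Σ-choices-^ : ∀ {A : Set} {n} x (w : A → ℕ) (xss : Fin n → List A) →
    Σ (choices (tabulateⱽ xss)) (λ v → x ^ sumⱽ (mapⱽ w v)) ≈ Π (λ i → Σ (xss i) (λ a → x ^ w a))
  Σ-choices-^ {n = zero}  x w xss = +-identityʳ 1#
  Σ-choices-^ {n = suc n} x w xss = begin
    Σ (choices (tabulateⱽ xss)) (λ v → x ^ sumⱽ (mapⱽ w v))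
      ≈⟨ Σ-cartesianProductWith _∷_ (xss zero) rest _ ⟩
    Σ (xss zero) (λ a → Σ rest (λ v → x ^ (w a ℕ.+ sumⱽ (mapⱽ w v))))
      ≈⟨ Σ-cong (xss zero) (λ a → Σ-cong rest (λ v → ^-+ x (w a) _)) ⟩
    Σ (xss zero) (λ a → Σ rest (λ v → x ^ w a * x ^ sumⱽ (mapⱽ w v)))
      ≈⟨ Σ-cong (xss zero) (λ a → Σ-*ˡ (x ^ w a) rest _) ⟩
    Σ (xss zero) (λ a → x ^ w a * Σ rest (λ v → x ^ sumⱽ (mapⱽ w v)))           ≈⟨ Σ-*ʳ _ (xss zero) _ ⟩
    Σ (xss zero) (λ a → x ^ w a) * Σ rest (λ v → x ^ sumⱽ (mapⱽ w v))
      ≈⟨ *-congˡ (Σ-choices-^ x w (xss ∘ suc)) ⟩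
    Π (λ i → Σ (xss i) (λ a → x ^ w a))                                         ∎
    where rest = choices (tabulateⱽ (xss ∘ suc))

-- A function f : ℕ → Carrier stands for the exponential generating function Σₘ f m tᵐ/m!;
-- its derivative is f ∘ suc, and ⊛ is the product, defined through the product rule.
module EGF (𝔸 : ℚ-Algebra) where

  open Sums 𝔸

  infixl 7 _⊛_
  _⊛_ : (ℕ → Carrier) → (ℕ → Carrier) → ℕ → Carrier
  (f ⊛ g) zero    = f 0 * g 0
  (f ⊛ g) (suc d) = ((f ∘ suc) ⊛ g) d + (f ⊛ (g ∘ suc)) d

  𝟙 : ℕ → Carrier
  𝟙 _ = 1#

  ⊛-cong-≤ : ∀ {f f′ g g′} d → (∀ i → i ≤ d → f i ≈ f′ i) → (∀ i → i ≤ d → g i ≈ g′ i) →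
             (f ⊛ g) d ≈ (f′ ⊛ g′) d
  ⊛-cong-≤ zero    e h = *-cong (e 0 z≤n) (h 0 z≤n)
  ⊛-cong-≤ (suc d) e h =
    +-cong (⊛-cong-≤ d (λ i → e (suc i) ∘ s≤s) (λ i → h i ∘ ℕ.m≤n⇒m≤1+n))
           (⊛-cong-≤ d (λ i → e i ∘ ℕ.m≤n⇒m≤1+n) (λ i → h (suc i) ∘ s≤s))

  ⊛-cong : ∀ {f f′ g g′} d → (∀ i → f i ≈ f′ i) → (∀ i → g i ≈ g′ i) → (f ⊛ g) d ≈ (f′ ⊛ g′) d
  ⊛-cong d e h = ⊛-cong-≤ d (λ i _ → e i) (λ i _ → h i)

  ⊛-comm : ∀ f g d → (f ⊛ g) d ≈ (g ⊛ f) d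
  ⊛-comm f g zero    = *-comm (f 0) (g 0)
  ⊛-comm f g (suc d) = trans (+-comm _ _) (+-cong (⊛-comm f (g ∘ suc) d) (⊛-comm (f ∘ suc) g d))

  ⊛-distribˡ : ∀ f g h d → (f ⊛ (λ i → g i + h i)) d ≈ (f ⊛ g) d + (f ⊛ h) d
  ⊛-distribˡ f g h zero    = distribˡ (f 0) (g 0) (h 0)
  ⊛-distribˡ f g h (suc d) = trans
    (+-cong (⊛-distribˡ (f ∘ suc) g h d) (⊛-distribˡ f (g ∘ suc) (h ∘ suc) d))
    (solve 4 (λ a b c d → (a :+ b) :+ (c :+ d) := (a :+ c) :+ (b :+ d)) refl _ _ _ _)

  ⊛-distribʳ : ∀ f g h d → ((λ i → g i + h i) ⊛ f) d ≈ (g ⊛ f) d + (h ⊛ f) d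
  ⊛-distribʳ f g h d = trans (⊛-comm _ f d)
    (trans (⊛-distribˡ f g h d) (+-cong (⊛-comm f g d) (⊛-comm f h d)))

  ⊛-scaleʳ : ∀ c f g d → (f ⊛ (λ i → c * g i)) d ≈ c * (f ⊛ g) d
  ⊛-scaleʳ c f g zero    = solve 3 (λ c a b → a :* (c :* b) := c :* (a :* b)) refl c (f 0) (g 0)
  ⊛-scaleʳ c f g (suc d) = trans (+-cong (⊛-scaleʳ c (f ∘ suc) g d) (⊛-scaleʳ c f (g ∘ suc) d))
    (sym (distribˡ c _ _))

  ⊛-scaleˡ : ∀ c f g d → ((λ i → c * f i) ⊛ g) d ≈ c * (f ⊛ g) d
  ⊛-scaleˡ c f g d = trans (⊛-comm _ g d) (trans (⊛-scaleʳ c g f d) (*-congˡ (⊛-comm g f d)))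

  ⊛-assoc : ∀ f g h d → ((f ⊛ g) ⊛ h) d ≈ (f ⊛ (g ⊛ h)) d
  ⊛-assoc f g h zero    = *-assoc (f 0) (g 0) (h 0)
  ⊛-assoc f g h (suc d) = begin
    ((λ i → (f′ ⊛ g) i + (f ⊛ g′) i) ⊛ h) d + ((f ⊛ g) ⊛ h′) d
      ≈⟨ +-congʳ (⊛-distribʳ h (f′ ⊛ g) (f ⊛ g′) d) ⟩
    ((f′ ⊛ g) ⊛ h) d + ((f ⊛ g′) ⊛ h) d + ((f ⊛ g) ⊛ h′) d
      ≈⟨ +-cong (+-cong (⊛-assoc f′ g h d) (⊛-assoc f g′ h d)) (⊛-assoc f g h′ d) ⟩
    (f′ ⊛ (g ⊛ h)) d + (f ⊛ (g′ ⊛ h)) d + (f ⊛ (g ⊛ h′)) d           ≈⟨ +-assoc _ _ _ ⟩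
    (f′ ⊛ (g ⊛ h)) d + ((f ⊛ (g′ ⊛ h)) d + (f ⊛ (g ⊛ h′)) d)
      ≈⟨ +-congˡ (⊛-distribˡ f (g′ ⊛ h) (g ⊛ h′) d) ⟨
    (f′ ⊛ (g ⊛ h)) d + (f ⊛ (λ i → (g′ ⊛ h) i + (g ⊛ h′) i)) d       ∎
    where f′ = f ∘ suc ; g′ = g ∘ suc ; h′ = h ∘ suc

  -- f = exp (y (eᵗ − 1)), as the solution of f′ = y eᵗ f with f(0) = 1.
  record IsTouchard (y : Carrier) (f : ℕ → Carrier) : Set where
    field
      at-zero : f 0 ≈ 1#
      at-suc  : ∀ d → f (suc d) ≈ y * (𝟙 ⊛ f) d
  open IsTouchard public

  touchard-unique-≤ : ∀ {y f g} → IsTouchard y f → IsTouchard y g → ∀ n d → d ≤ n → f d ≈ g d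
  touchard-unique-≤ F G n       zero    _         = trans (F .at-zero) (sym (G .at-zero))
  touchard-unique-≤ F G (suc n) (suc d) (s≤s d≤n) = begin
    _                ≈⟨ F .at-suc d ⟩
    _ * (𝟙 ⊛ _) d
      ≈⟨ *-congˡ (⊛-cong-≤ d (λ _ _ → refl) (λ i i≤d → touchard-unique-≤ F G n i (ℕ.≤-trans i≤d d≤n))) ⟩
    _ * (𝟙 ⊛ _) d    ≈⟨ G .at-suc d ⟨
    _                ∎

  touchard-unique : ∀ {y f g} → IsTouchard y f → IsTouchard y g → ∀ d → f d ≈ g d
  touchard-unique F G d = touchard-unique-≤ F G d d ℕ.≤-refl

  touchard-cong : ∀ {y z f} → y ≈ z → IsTouchard y f → IsTouchard z f
  touchard-cong y≈z F .at-zero  = F .at-zero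
  touchard-cong y≈z F .at-suc d = trans (F .at-suc d) (*-congʳ y≈z)

  touchard-⊛ : ∀ {y z f g} → IsTouchard y f → IsTouchard z g → IsTouchard (y + z) (f ⊛ g)
  touchard-⊛ F G .at-zero = trans (*-cong (F .at-zero) (G .at-zero)) (*-identityˡ 1#)
  touchard-⊛ {y} {z} {f} {g} F G .at-suc d = begin
    ((f ∘ suc) ⊛ g) d + (f ⊛ (g ∘ suc)) d
      ≈⟨ +-cong (⊛-cong d (F .at-suc) (λ _ → refl)) (⊛-cong d (λ _ → refl) (G .at-suc)) ⟩
    ((λ i → y * (𝟙 ⊛ f) i) ⊛ g) d + (f ⊛ (λ i → z * (𝟙 ⊛ g) i)) d
      ≈⟨ +-cong (⊛-scaleˡ y (𝟙 ⊛ f) g d) (⊛-scaleʳ z f (𝟙 ⊛ g) d) ⟩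
    y * ((𝟙 ⊛ f) ⊛ g) d + z * (f ⊛ (𝟙 ⊛ g)) d
      ≈⟨ +-cong (*-congˡ (⊛-assoc 𝟙 f g d)) (*-congˡ exchange) ⟩
    y * (𝟙 ⊛ (f ⊛ g)) d + z * (𝟙 ⊛ (f ⊛ g)) d                      ≈⟨ distribʳ _ y z ⟨
    (y + z) * (𝟙 ⊛ (f ⊛ g)) d                                      ∎
    where
    exchange : (f ⊛ (𝟙 ⊛ g)) d ≈ (𝟙 ⊛ (f ⊛ g)) d
    exchange = begin
      (f ⊛ (𝟙 ⊛ g)) d   ≈⟨ ⊛-assoc f 𝟙 g d ⟨
      ((f ⊛ 𝟙) ⊛ g) d   ≈⟨ ⊛-cong d (⊛-comm f 𝟙) (λ _ → refl) ⟩
      ((𝟙 ⊛ f) ⊛ g) d   ≈⟨ ⊛-assoc 𝟙 f g d ⟩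
      (𝟙 ⊛ (f ⊛ g)) d   ∎

  -- t f′, the Euler operator
  θ : (ℕ → Carrier) → ℕ → Carrier
  θ f d = ν d * f d

  θ-⊛ : ∀ f g d → (θ f ⊛ g) (suc d) ≈ ν (suc d) * ((f ∘ suc) ⊛ g) d
  θ-⊛ f g d = begin
    ((θ f ∘ suc) ⊛ g) d + (θ f ⊛ (g ∘ suc)) d
      ≈⟨ +-congʳ (⊛-cong d (λ i → trans (*-congʳ (ν-suc i))
        (solve 2 (λ n a → (con 1 :+ n) :* a := a :+ n :* a) refl (ν i) (f (suc i)))) (λ _ → refl)) ⟩
    ((λ i → f′ i + θ f′ i) ⊛ g) d + (θ f ⊛ (g ∘ suc)) d
      ≈⟨ +-congʳ (⊛-distribʳ g f′ (θ f′) d) ⟩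
    (f′ ⊛ g) d + (θ f′ ⊛ g) d + (θ f ⊛ (g ∘ suc)) d                       ≈⟨ +-assoc _ _ _ ⟩
    (f′ ⊛ g) d + ((θ f′ ⊛ g) d + (θ f ⊛ (g ∘ suc)) d)                     ≈⟨ +-congˡ (rest d) ⟩
    (f′ ⊛ g) d + ν d * (f′ ⊛ g) d
      ≈⟨ solve 2 (λ n a → a :+ n :* a := (con 1 :+ n) :* a) refl (ν d) ((f′ ⊛ g) d) ⟩
    (1# + ν d) * (f′ ⊛ g) d                                               ≈⟨ *-congʳ (ν-suc d) ⟨
    ν (suc d) * (f′ ⊛ g) d                                                ∎
    where
    f′ = f ∘ suc
    rest : ∀ d → (θ f′ ⊛ g) d + (θ f ⊛ (g ∘ suc)) d ≈ ν d * (f′ ⊛ g) d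
    rest zero = begin
      ν 0 * f 1 * g 0 + ν 0 * f 0 * g 1   ≈⟨ +-cong (*-congʳ (*-congʳ ι-0)) (*-congʳ (*-congʳ ι-0)) ⟩
      0# * f 1 * g 0 + 0# * f 0 * g 1
        ≈⟨ solve 4 (λ a b c d → con 0 :* a :* b :+ con 0 :* c :* d := con 0 :* (a :* b)) refl (f 1)
          (g 0) (f 0) (g 1) ⟩
      0# * (f 1 * g 0)                    ≈⟨ *-congʳ ι-0 ⟨
      ν 0 * (f 1 * g 0)                   ∎
    rest (suc d) = begin
      (θ f′ ⊛ g) (suc d) + (θ f ⊛ (g ∘ suc)) (suc d)
        ≈⟨ +-cong (θ-⊛ f′ g d) (θ-⊛ f (g ∘ suc) d) ⟩
      ν (suc d) * ((f′ ∘ suc) ⊛ g) d + ν (suc d) * (f′ ⊛ (g ∘ suc)) d     ≈⟨ distribˡ _ _ _ ⟨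
      ν (suc d) * (f′ ⊛ g) (suc d)                                        ∎

  θ-touchard-⊛ : ∀ {c y z f g h} → IsTouchard y f → IsTouchard z g → y + z ≈ c * y → IsTouchard
    (c * y) h →
                 ∀ d → c * (θ f ⊛ g) (suc d) ≈ ν (suc d) * h (suc d)
  θ-touchard-⊛ {c} {y} {z} {f} {g} {h} F G y+z≈cy H d = begin
    c * (θ f ⊛ g) (suc d)                              ≈⟨ *-congˡ (θ-⊛ f g d) ⟩
    c * (ν (suc d) * ((f ∘ suc) ⊛ g) d)
      ≈⟨ *-congˡ (*-congˡ (⊛-cong d (F .at-suc) (λ _ → refl))) ⟩
    c * (ν (suc d) * ((λ i → y * (𝟙 ⊛ f) i) ⊛ g) d)
      ≈⟨ *-congˡ (*-congˡ (trans (⊛-scaleˡ y (𝟙 ⊛ f) g d) (*-congˡ (⊛-assoc 𝟙 f g d)))) ⟩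
    c * (ν (suc d) * (y * (𝟙 ⊛ (f ⊛ g)) d))
      ≈⟨ solve 4 (λ c n y a → c :* (n :* (y :* a)) := n :* (c :* y :* a)) refl c (ν (suc d)) y _ ⟩
    ν (suc d) * (c * y * (𝟙 ⊛ (f ⊛ g)) d)              ≈⟨ *-congˡ (FG .at-suc d) ⟨
    ν (suc d) * (f ⊛ g) (suc d)                        ≈⟨ *-congˡ (touchard-unique FG H (suc d)) ⟩
    ν (suc d) * h (suc d)                              ∎
    where FG = touchard-cong y+z≈cy (touchard-⊛ F G)

private variable n : ℕ

x∈p─q⇒x∉q : ∀ (p q : Subset n) {v} → v ∈ p ─ q → v ∉ q
x∈p─q⇒x∉q (inside ∷ p) (inside ∷ q) () here
x∈p─q⇒x∉q (_ ∷ p) (_ ∷ q) (there v∈) (there v∈q) = x∈p─q⇒x∉q p q v∈ v∈q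

∣p∣≡0⇒p≡∅ : ∀ (p : Subset n) → ∣ p ∣ ≡ 0 → p ≡ ∅
∣p∣≡0⇒p≡∅ []            e = ≡-refl
∣p∣≡0⇒p≡∅ (outside ∷ p) e = cong (outside ∷_) (∣p∣≡0⇒p≡∅ p e)

∣p∣≡suc⇒Nonempty : ∀ (p : Subset n) {k} → ∣ p ∣ ≡ suc k → Nonempty p
∣p∣≡suc⇒Nonempty (inside  ∷ p) e = zero , here
∣p∣≡suc⇒Nonempty (outside ∷ p) e with v , v∈p ← ∣p∣≡suc⇒Nonempty p e = suc v , there v∈p

∣p∣≡∣q∣+∣p─q∣ : ∀ (p q : Subset n) → q ⊆ p → ∣ p ∣ ≡ ∣ q ∣ ℕ.+ ∣ p ─ q ∣
∣p∣≡∣q∣+∣p─q∣ []            []            q⊆p = ≡-refl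
∣p∣≡∣q∣+∣p─q∣ (inside ∷ p)  (inside ∷ q)  q⊆p = cong suc (∣p∣≡∣q∣+∣p─q∣ p q (drop-∷-⊆ q⊆p))
∣p∣≡∣q∣+∣p─q∣ (outside ∷ p) (inside ∷ q)  q⊆p with () ← q⊆p here
∣p∣≡∣q∣+∣p─q∣ (inside ∷ p)  (outside ∷ q) q⊆p = ≡-trans (cong suc (∣p∣≡∣q∣+∣p─q∣ p q (drop-∷-⊆ q⊆p)))
  (≡-sym (ℕ.+-suc ∣ q ∣ _))
∣p∣≡∣q∣+∣p─q∣ (outside ∷ p) (outside ∷ q) q⊆p = ∣p∣≡∣q∣+∣p─q∣ p q (drop-∷-⊆ q⊆p)

in⊈out : ∀ {p q : Subset n} → ¬ (inside ∷ p ⊆ outside ∷ q)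
in⊈out h with () ← h here

IsBlockOf : Subset n → Subset n → Set
IsBlockOf S b = Nonempty b × b ⊆ S

isBlockOf? : ∀ (S b : Subset n) → Dec (IsBlockOf S b)
isBlockOf? S b = nonempty? b ×-dec b ⊆? S

∈⋃⇒∉ : ∀ {b : Subset n} {π} → All (λ c → Empty (b ∩ c)) π → ∀ {v} → v ∈ ⋃ π → v ∉ b
∈⋃⇒∉ []             v∈ = ⊥-elim (∉⊥ v∈)
∈⋃⇒∉ {π = c ∷ π} (d ∷ ds) v∈ v∈b with x∈p∪q⁻ c (⋃ π) v∈
... | inj₁ v∈c = d (_ , x∈p∩q⁺ (v∈b , v∈c))
... | inj₂ v∈π = ∈⋃⇒∉ ds v∈π v∈b

∉⇒disjoint : ∀ {b : Subset n} {π} → (∀ {v} → v ∈ ⋃ π → v ∉ b) → All (λ c → Empty (b ∩ c)) π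
∉⇒disjoint {π = []}    h = []
∉⇒disjoint {b = b} {c ∷ π} h =
  (λ { (v , v∈) → let v∈b , v∈c = x∈p∩q⁻ b c v∈ in h (p⊆p∪q (⋃ π) v∈c) v∈b }) ∷
  ∉⇒disjoint (h ∘ q⊆p∪q c (⋃ π))

module _ {S b : Subset n} {π : List (Subset n)} where

  uncons : IsSetPartition S (b ∷ π) → IsBlockOf S b × IsSetPartition (S ─ b) π
  uncons (ne ∷ nes , d ∷ ds , ≡-refl) = (ne , p⊆p∪q (⋃ π)) , nes , ds , ⊆-antisym
    (λ v∈ → x∈p∧x∉q⇒x∈p─q (q⊆p∪q b (⋃ π) v∈) (∈⋃⇒∉ d v∈))
    (λ v∈ → from (x∈p∪q⁻ b (⋃ π) (p─q⊆p (b ∪ ⋃ π) b v∈)) (x∈p─q⇒x∉q (b ∪ ⋃ π) b v∈))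
    where
    from : ∀ {v} → _ → v ∉ b → v ∈ ⋃ π
    from (inj₁ v∈b) v∉b = contradiction v∈b v∉b
    from (inj₂ v∈π) v∉b = v∈π

  recons : IsBlockOf S b × IsSetPartition (S ─ b) π → IsSetPartition S (b ∷ π)
  recons ((ne , b⊆S) , nes , ds , e) = ne ∷ nes , ∉⇒disjoint (x∈p─q⇒x∉q S b ∘ subst (_ ∈_) e) ∷ ds ,
    ⊆-antisym
    (λ {v} v∈ → to (x∈p∪q⁻ b (⋃ π) v∈))
    (λ {v} v∈ → from v∈ (v ∈? b))
    where
    to : ∀ {v} → _ → v ∈ S
    to (inj₁ v∈b) = b⊆S v∈b
    to (inj₂ v∈π) = p─q⊆p S b (subst (_ ∈_) e v∈π)
    from : ∀ {v} → v ∈ S → Dec (v ∈ b) → v ∈ b ∪ ⋃ π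
    from v∈S (yes v∈b) = p⊆p∪q (⋃ π) v∈b
    from v∈S (no v∉b)  = q⊆p∪q b (⋃ π) (subst (_ ∈_) (≡-sym e) (x∈p∧x∉q⇒x∈p─q v∈S v∉b))

module SubsetSums (𝔸 : ℚ-Algebra) where

  open Sums 𝔸
  open EGF 𝔸

  Σ-subsets-suc : ∀ n (f : Subset (suc n) → Carrier) →
    Σ (subsets (suc n)) f ≈ Σ (subsets n) (λ c → f (outside ∷ c)) + Σ (subsets n) (λ c → f (inside ∷ c))
  Σ-subsets-suc n f = trans (Σ-cartesianProductWith _∷_ (outside ∷ inside ∷ []) (subsets n) f)
    (+-congˡ (+-identityʳ _))

  Σ-subsets-⊆ : ∀ (f g : ℕ → Carrier) (U : Subset n) →
    Σ (subsets n) (λ c → ⟦ c ⊆? U ⟧ * (f ∣ c ∣ * g ∣ U ─ c ∣)) ≈ (f ⊛ g) ∣ U ∣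
  Σ-subsets-⊆ f g [] = trans (+-identityʳ _)
    (trans (*-congʳ (⟦⟧-true ([] ⊆? []) (λ ()))) (*-identityˡ _))
  Σ-subsets-⊆ {suc n} f g (outside ∷ U) = begin
    Σ (subsets (suc n)) _                                                ≈⟨ Σ-subsets-suc n _ ⟩
    Σ (subsets n) _ + Σ (subsets n) _                                    ≈⟨ +-cong
      (Σ-cong (subsets n) (λ c → *-congʳ
        (⟦⟧-cong ((outside ∷ c) ⊆? (outside ∷ U)) (c ⊆? U) drop-∷-⊆ out⊆)))
      (Σ-zero (subsets n) (λ c → ⟦⟧-vanish ((inside ∷ c) ⊆? (outside ∷ U)) in⊈out)) ⟩
    Σ (subsets n) (λ c → ⟦ c ⊆? U ⟧ * (f ∣ c ∣ * g ∣ U ─ c ∣)) + 0#      ≈⟨ +-identityʳ _ ⟩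
    Σ (subsets n) (λ c → ⟦ c ⊆? U ⟧ * (f ∣ c ∣ * g ∣ U ─ c ∣))           ≈⟨ Σ-subsets-⊆ f g U ⟩
    (f ⊛ g) ∣ U ∣                                                        ∎
  Σ-subsets-⊆ {suc n} f g (inside ∷ U) = begin
    Σ (subsets (suc n)) _                                                ≈⟨ Σ-subsets-suc n _ ⟩
    Σ (subsets n) _ + Σ (subsets n) _                                    ≈⟨ +-cong
      (Σ-cong (subsets n) (λ c → *-congʳ
        (⟦⟧-cong ((outside ∷ c) ⊆? (inside ∷ U)) (c ⊆? U) drop-∷-⊆ out⊆)))
      (Σ-cong (subsets n) (λ c → *-congʳ
        (⟦⟧-cong ((inside ∷ c) ⊆? (inside ∷ U)) (c ⊆? U) drop-∷-⊆ in⊆in))) ⟩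
    Σ (subsets n) (λ c → ⟦ c ⊆? U ⟧ * (f ∣ c ∣ * g (suc ∣ U ─ c ∣))) +
    Σ (subsets n) (λ c → ⟦ c ⊆? U ⟧ * (f (suc ∣ c ∣) * g ∣ U ─ c ∣))
      ≈⟨ +-cong (Σ-subsets-⊆ f (g ∘ suc) U) (Σ-subsets-⊆ (f ∘ suc) g U) ⟩
    (f ⊛ (g ∘ suc)) ∣ U ∣ + ((f ∘ suc) ⊛ g) ∣ U ∣                        ≈⟨ +-comm _ _ ⟩
    (f ⊛ g) (suc ∣ U ∣)                                                  ∎

  Σ-subsets-∈-⊆ : ∀ (g : ℕ → Carrier) (S : Subset n) {v} → v ∈ S → ∀ {k} → ∣ S ∣ ≡ suc k →
    Σ (subsets n) (λ c → ⟦ (v ∈? c) ×-dec (c ⊆? S) ⟧ * g ∣ S ─ c ∣) ≈ (𝟙 ⊛ g) k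
  Σ-subsets-∈-⊆ {suc n} g (inside ∷ S) here ≡-refl = begin
    Σ (subsets (suc n)) _                                                ≈⟨ Σ-subsets-suc n _ ⟩
    Σ (subsets n) _ + Σ (subsets n) _                                    ≈⟨ +-cong
      (Σ-zero (subsets n) (λ c → ⟦⟧-vanish
        ((zero ∈? (outside ∷ c)) ×-dec ((outside ∷ c) ⊆? (inside ∷ S))) (λ { (() , _) })))
      (Σ-cong (subsets n) (λ c → *-cong
        (⟦⟧-cong ((zero ∈? (inside ∷ c)) ×-dec ((inside ∷ c) ⊆? (inside ∷ S))) (c ⊆? S)
        (λ (_ , h) → drop-∷-⊆ h) (λ h → here , in⊆in h)) (sym (*-identityˡ _)))) ⟩
    0# + Σ (subsets n) (λ c → ⟦ c ⊆? S ⟧ * (1# * g ∣ S ─ c ∣))           ≈⟨ +-identityˡ _ ⟩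
    Σ (subsets n) (λ c → ⟦ c ⊆? S ⟧ * (1# * g ∣ S ─ c ∣))                ≈⟨ Σ-subsets-⊆ 𝟙 g S ⟩
    (𝟙 ⊛ g) ∣ S ∣                                                        ∎
  Σ-subsets-∈-⊆ {suc n} g (outside ∷ S) {suc v} (there v∈S) e = begin
    Σ (subsets (suc n)) _                                                ≈⟨ Σ-subsets-suc n _ ⟩
    Σ (subsets n) _ + Σ (subsets n) _                                    ≈⟨ +-cong
      (Σ-cong (subsets n) (λ c → *-congʳ
        (⟦⟧-cong ((suc v ∈? (outside ∷ c)) ×-dec ((outside ∷ c) ⊆? (outside ∷ S)))
        ((v ∈? c) ×-dec (c ⊆? S)) (λ (v∈ , h) → drop-there v∈ , drop-∷-⊆ h)
        (λ (v∈ , h) → there v∈ , out⊆ h))))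
      (Σ-zero (subsets n) (λ c → ⟦⟧-vanish
        ((suc v ∈? (inside ∷ c)) ×-dec ((inside ∷ c) ⊆? (outside ∷ S))) (in⊈out ∘ proj₂))) ⟩
    Σ (subsets n) (λ c → ⟦ (v ∈? c) ×-dec (c ⊆? S) ⟧ * g ∣ S ─ c ∣) + 0# ≈⟨ +-identityʳ _ ⟩
    Σ (subsets n) (λ c → ⟦ (v ∈? c) ×-dec (c ⊆? S) ⟧ * g ∣ S ─ c ∣)      ≈⟨ Σ-subsets-∈-⊆ g S v∈S e ⟩
    _                                                                    ∎
  Σ-subsets-∈-⊆ {suc n} g (inside ∷ S) {suc v} (there v∈S) {zero} e =
    ⊥-elim (∉⊥ (subst (v ∈_) (∣p∣≡0⇒p≡∅ S (ℕ.suc-injective e)) v∈S))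
  Σ-subsets-∈-⊆ {suc n} g (inside ∷ S) {suc v} (there v∈S) {suc k} e = begin
    Σ (subsets (suc n)) _                                                ≈⟨ Σ-subsets-suc n _ ⟩
    Σ (subsets n) _ + Σ (subsets n) _                                    ≈⟨ +-cong
      (Σ-cong (subsets n) (λ c → *-congʳ
        (⟦⟧-cong ((suc v ∈? (outside ∷ c)) ×-dec ((outside ∷ c) ⊆? (inside ∷ S)))
        ((v ∈? c) ×-dec (c ⊆? S)) (λ (v∈ , h) → drop-there v∈ , drop-∷-⊆ h)
        (λ (v∈ , h) → there v∈ , out⊆ h))))
      (Σ-cong (subsets n) (λ c → *-congʳ
        (⟦⟧-cong ((suc v ∈? (inside ∷ c)) ×-dec ((inside ∷ c) ⊆? (inside ∷ S)))
        ((v ∈? c) ×-dec (c ⊆? S)) (λ (v∈ , h) → drop-there v∈ , drop-∷-⊆ h)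
        (λ (v∈ , h) → there v∈ , in⊆in h)))) ⟩
    Σ (subsets n) (λ c → ⟦ (v ∈? c) ×-dec (c ⊆? S) ⟧ * g (suc ∣ S ─ c ∣)) +
    Σ (subsets n) (λ c → ⟦ (v ∈? c) ×-dec (c ⊆? S) ⟧ * g ∣ S ─ c ∣)
      ≈⟨ +-cong (Σ-subsets-∈-⊆ (g ∘ suc) S v∈S (ℕ.suc-injective e))
        (Σ-subsets-∈-⊆ g S v∈S (ℕ.suc-injective e)) ⟩
    (𝟙 ⊛ (g ∘ suc)) k + (𝟙 ⊛ g) k                                        ≈⟨ +-comm _ _ ⟩
    (𝟙 ⊛ g) (suc k)                                                      ∎

  Σ-subsets-≡ : ∀ (C : Subset n) → Σ (subsets n) (λ c → ⟦ ≡-decⱽ _≟ᵇ_ c C ⟧) ≈ 1#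
  Σ-subsets-≡ {n} C = Σ-choices-≡ _≟ᵇ_ (≡-decⱽ _≟ᵇ_) (replicate n (outside ∷ inside ∷ [])) C
    (λ i → once i (lookup C i))
    where
    once : ∀ {n} (i : Fin n) b → Σ (lookup (replicate n (outside ∷ inside ∷ [])) i) (λ a → ⟦ a ≟ᵇ b ⟧)
      ≈ 1#
    once zero    false = trans (+-congˡ (+-identityˡ 0#)) (+-identityʳ 1#)
    once zero    true  = trans (+-identityˡ _) (+-identityʳ 1#)
    once (suc i) b     = once i b

  module _ (x : Carrier) where

    -- The list L of admissible blocks varies because P-block is proved by induction on it.
    P : List (Subset n) → Subset n → Carrier
    P L S = Σ (sublists L) (λ π → ⟦ isSetPartition? S π ⟧ * x ^ length π)

    P-∷ : ∀ (b : Subset n) L S → P (b ∷ L) S ≈ P L S + ⟦ isBlockOf? S b ⟧ * (x * P L (S ─ b))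
    P-∷ b L S = begin
      P (b ∷ L) S
        ≈⟨ Σ-++ (sublists L) (map (b ∷_) (sublists L)) _ ⟩
      P L S + Σ (map (b ∷_) (sublists L)) (λ π → ⟦ isSetPartition? S π ⟧ * x ^ length π)
        ≈⟨ +-congˡ (Σ-map (b ∷_) (sublists L) _) ⟩
      P L S + Σ (sublists L) (λ π → ⟦ isSetPartition? S (b ∷ π) ⟧ * (x * x ^ length π))
        ≈⟨ +-congˡ (Σ-cong (sublists L) term) ⟩
      P L S + Σ (sublists L) (λ π → ⟦ isBlockOf? S b ⟧ *
        (x * (⟦ isSetPartition? (S ─ b) π ⟧ * x ^ length π)))
        ≈⟨ +-congˡ (trans (Σ-*ˡ _ (sublists L) _) (*-congˡ (Σ-*ˡ x (sublists L) _))) ⟩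
      P L S + ⟦ isBlockOf? S b ⟧ * (x * P L (S ─ b))                                       ∎
      where
      term : ∀ π → ⟦ isSetPartition? S (b ∷ π) ⟧ * (x * x ^ length π) ≈
                   ⟦ isBlockOf? S b ⟧ * (x * (⟦ isSetPartition? (S ─ b) π ⟧ * x ^ length π))
      term π = begin
        ⟦ isSetPartition? S (b ∷ π) ⟧ * (x * x ^ length π)
          ≈⟨ *-congʳ (⟦⟧-cong (isSetPartition? S (b ∷ π))
            (isBlockOf? S b ×-dec isSetPartition? (S ─ b) π) uncons recons) ⟩
        ⟦ isBlockOf? S b ×-dec isSetPartition? (S ─ b) π ⟧ * (x * x ^ length π)
          ≈⟨ *-congʳ (⟦⟧-× (isBlockOf? S b) (isSetPartition? (S ─ b) π)) ⟩
        ⟦ isBlockOf? S b ⟧ * ⟦ isSetPartition? (S ─ b) π ⟧ * (x * x ^ length π)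
          ≈⟨ solve 4 (λ a b x y → a :* b :* (x :* y) := a :* (x :* (b :* y))) refl ⟦ isBlockOf? S b ⟧ ⟦
            isSetPartition? (S ─ b) π ⟧ x (x ^ length π) ⟩
        ⟦ isBlockOf? S b ⟧ * (x * (⟦ isSetPartition? (S ─ b) π ⟧ * x ^ length π)) ∎

    -- Choosing the block c of v first.
    P-block : ∀ L (S : Subset n) {v} → v ∈ S →
      P L S ≈ Σ L (λ c → ⟦ (v ∈? c) ×-dec (c ⊆? S) ⟧ * (x * P L (S ─ c)))
    P-block []      S {v} v∈S = trans (+-identityʳ _)
      (⟦⟧-vanish (isSetPartition? S []) λ { (_ , _ , ≡-refl) → ∉⊥ v∈S })
    P-block (b ∷ L) S {v} v∈S = begin
      P (b ∷ L) S
        ≈⟨ P-∷ b L S ⟩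
      P L S + B S * (x * P L (S ─ b))
        ≈⟨ +-cong (P-block L S v∈S) (own (v ∈? b)) ⟩
      Σ L (λ c → I S c * (x * P L (S ─ c))) +
        (I S b * (x * P (b ∷ L) (S ─ b)) + Σ L
        (λ c → I S c * (x * (B (S ─ c) * (x * P L (S ─ c ─ b))))))
        ≈⟨ solve 3 (λ a b c → a :+ (b :+ c) := b :+ (a :+ c)) refl _ _ _ ⟩
      I S b * (x * P (b ∷ L) (S ─ b)) +
        (Σ L (λ c → I S c * (x * P L (S ─ c))) + Σ L
        (λ c → I S c * (x * (B (S ─ c) * (x * P L (S ─ c ─ b))))))
        ≈⟨ +-congˡ (Σ-+ L _ _) ⟨
      I S b * (x * P (b ∷ L) (S ─ b)) + Σ L
        (λ c → I S c * (x * P L (S ─ c)) + I S c * (x * (B (S ─ c) * (x * P L (S ─ c ─ b)))))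
        ≈⟨ +-congˡ (Σ-cong L (λ c → trans (sym (distribˡ _ _ _))
          (*-congˡ (trans (sym (distribˡ _ _ _)) (*-congˡ (sym (P-∷ b L (S ─ c)))))))) ⟩
      I S b * (x * P (b ∷ L) (S ─ b)) + Σ L (λ c → I S c * (x * P (b ∷ L) (S ─ c))) ∎
      where
      I : Subset _ → Subset _ → Carrier
      I S c = ⟦ (v ∈? c) ×-dec (c ⊆? S) ⟧
      B : Subset _ → Carrier
      B S = ⟦ isBlockOf? S b ⟧

      own : Dec (v ∈ b) → B S * (x * P L (S ─ b)) ≈
        I S b * (x * P (b ∷ L) (S ─ b)) + Σ L (λ c → I S c * (x * (B (S ─ c) * (x * P L (S ─ c ─ b)))))
      own (yes v∈b) = begin
        B S * (x * P L (S ─ b))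
          ≈⟨ *-cong (⟦⟧-cong (isBlockOf? S b) ((v ∈? b) ×-dec (b ⊆? S)) (λ (_ , b⊆S) → v∈b , b⊆S)
            (λ (_ , b⊆S) → (v , v∈b) , b⊆S)) (*-congˡ (sym shrink)) ⟩
        I S b * (x * P (b ∷ L) (S ─ b))
          ≈⟨ +-identityʳ _ ⟨
        I S b * (x * P (b ∷ L) (S ─ b)) + 0#
          ≈⟨ +-congˡ (Σ-zero L (λ c → trans
            (⟦⟧-guard ((v ∈? c) ×-dec (c ⊆? S))
            (λ (v∈c , _) → trans (*-congˡ
            (⟦⟧-vanish (isBlockOf? (S ─ c) b) (λ (_ , h) → x∈p─q⇒x∉q S c (h v∈b) v∈c))) (zeroʳ x)))
            (zeroʳ _))) ⟨
        I S b * (x * P (b ∷ L) (S ─ b)) + Σ L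
          (λ c → I S c * (x * (B (S ─ c) * (x * P L (S ─ c ─ b))))) ∎
        where
        shrink : P (b ∷ L) (S ─ b) ≈ P L (S ─ b)
        shrink = trans (P-∷ b L (S ─ b))
          (trans (+-congˡ (⟦⟧-vanish (isBlockOf? (S ─ b) b) (λ (_ , h) → x∈p─q⇒x∉q S b (h v∈b) v∈b)))
          (+-identityʳ _))
      own (no v∉b) = begin
        B S * (x * P L (S ─ b))
          ≈⟨ ⟦⟧-guard (isBlockOf? S b) (λ _ → *-congˡ (P-block L (S ─ b) (x∈p∧x∉q⇒x∈p─q v∈S v∉b))) ⟩
        B S * (x * Σ L (λ c → I (S ─ b) c * (x * P L (S ─ b ─ c))))
          ≈⟨ trans (*-congˡ (sym (Σ-*ˡ x L _))) (sym (Σ-*ˡ (B S) L _)) ⟩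
        Σ L (λ c → B S * (x * (I (S ─ b) c * (x * P L (S ─ b ─ c)))))
          ≈⟨ Σ-cong L commute ⟩
        Σ L (λ c → I S c * (x * (B (S ─ c) * (x * P L (S ─ c ─ b)))))
          ≈⟨ +-identityˡ _ ⟨
        0# + Σ L (λ c → I S c * (x * (B (S ─ c) * (x * P L (S ─ c ─ b)))))
          ≈⟨ +-congʳ (⟦⟧-vanish ((v ∈? b) ×-dec (b ⊆? S)) (v∉b ∘ proj₁)) ⟨
        I S b * (x * P (b ∷ L) (S ─ b)) + Σ L
          (λ c → I S c * (x * (B (S ─ c) * (x * P L (S ─ c ─ b))))) ∎
        where
        ⊆─ : ∀ {T b c : Subset _} → (∀ {w} → w ∈ b → w ∉ c) → b ⊆ T → b ⊆ T ─ c
        ⊆─ disjoint b⊆T w∈b = x∈p∧x∉q⇒x∈p─q (b⊆T w∈b) (disjoint w∈b)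
        swap : ∀ c → B S * I (S ─ b) c ≈ I S c * B (S ─ c)
        swap c = trans (sym (⟦⟧-× (isBlockOf? S b) ((v ∈? c) ×-dec (c ⊆? (S ─ b))))) (trans
          (⟦⟧-cong (isBlockOf? S b ×-dec ((v ∈? c) ×-dec (c ⊆? (S ─ b))))
            (((v ∈? c) ×-dec (c ⊆? S)) ×-dec isBlockOf? (S ─ c) b)
            (λ ((ne , b⊆S) , v∈c , c⊆S─b) → (v∈c , p─q⊆p S b ∘ c⊆S─b) , ne , ⊆─
              (λ w∈b w∈c → x∈p─q⇒x∉q S b (c⊆S─b w∈c) w∈b) b⊆S)
            (λ ((v∈c , c⊆S) , ne , b⊆S─c) → (ne , p─q⊆p S c ∘ b⊆S─c) , v∈c , ⊆─
              (λ w∈c w∈b → x∈p─q⇒x∉q S c (b⊆S─c w∈b) w∈c) c⊆S))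
          (⟦⟧-× ((v ∈? c) ×-dec (c ⊆? S)) (isBlockOf? (S ─ c) b)))
        commute : ∀ c → B S * (x * (I (S ─ b) c * (x * P L (S ─ b ─ c)))) ≈ I S c *
          (x * (B (S ─ c) * (x * P L (S ─ c ─ b))))
        commute c = begin
          B S * (x * (I (S ─ b) c * (x * P L (S ─ b ─ c))))
            ≡⟨ cong (λ T → B S * (x * (I (S ─ b) c * (x * P L T)))) (p─q─r≡p─r─q S b c) ⟩
          B S * (x * (I (S ─ b) c * (x * P L (S ─ c ─ b))))
            ≈⟨ solve 4 (λ a b x y → a :* (x :* (b :* (x :* y))) := a :* b :* (x :* (x :* y))) refl
              (B S) (I (S ─ b) c) x (P L (S ─ c ─ b)) ⟩
          B S * I (S ─ b) c * (x * (x * P L (S ─ c ─ b)))     ≈⟨ *-congʳ (swap c) ⟩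
          I S c * B (S ─ c) * (x * (x * P L (S ─ c ─ b)))
            ≈⟨ solve 4 (λ a b x y → a :* (x :* (b :* (x :* y))) := a :* b :* (x :* (x :* y))) refl
              (I S c) (B (S ─ c)) x (P L (S ─ c ─ b)) ⟨
          I S c * (x * (B (S ─ c) * (x * P L (S ─ c ─ b))))   ∎

    P-∅ : ∀ {n} (L : List (Subset n)) → P L ∅ ≈ 1#
    P-∅ {n} []      = trans (+-identityʳ _)
      (trans (*-congʳ (⟦⟧-true (isSetPartition? {n} ∅ []) ([] , [] , ≡-refl))) (*-identityˡ 1#))
    P-∅ (b ∷ L) = trans (P-∷ b L ∅)
      (trans (+-cong (P-∅ L) (⟦⟧-vanish (isBlockOf? ∅ b) (λ ((v , v∈b) , b⊆∅) → ∉⊥ (b⊆∅ v∈b))))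
      (+-identityʳ 1#))

    Σ-setPartitions : ∀ {w} → IsTouchard x w → ∀ (S : Subset n) → Σ (setPartitions S)
      (λ π → x ^ length π) ≈ w ∣ S ∣
    Σ-setPartitions {n} {w} T S = trans (Σ-filter (isSetPartition? S) (sublists (subsets n)) _)
      (count ∣ S ∣ S ℕ.≤-refl)
      where
      count : ∀ k S → ∣ S ∣ ≤ k → P (subsets n) S ≈ w ∣ S ∣
      count k S S≤k with ∣ S ∣ in e
      count k S S≤k | zero rewrite ∣p∣≡0⇒p≡∅ S e = trans (P-∅ (subsets n)) (sym (T .at-zero))
      count (suc k) S (s≤s d≤k) | suc d with v , v∈S ← ∣p∣≡suc⇒Nonempty S e = begin
        P (subsets n) S
          ≈⟨ P-block (subsets n) S v∈S ⟩
        Σ (subsets n) (λ c → ⟦ (v ∈? c) ×-dec (c ⊆? S) ⟧ * (x * P (subsets n) (S ─ c)))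
          ≈⟨ Σ-cong (subsets n) (λ c → ⟦⟧-guard ((v ∈? c) ×-dec (c ⊆? S))
            (λ (v∈c , c⊆S) → *-congˡ (count k (S ─ c) (smaller v∈c)))) ⟩
        Σ (subsets n) (λ c → ⟦ (v ∈? c) ×-dec (c ⊆? S) ⟧ * (x * w ∣ S ─ c ∣))
          ≈⟨ Σ-subsets-∈-⊆ (λ i → x * w i) S v∈S e ⟩
        (𝟙 ⊛ (λ i → x * w i)) d
          ≈⟨ ⊛-scaleʳ x 𝟙 w d ⟩
        x * (𝟙 ⊛ w) d
          ≈⟨ T .at-suc d ⟨
        w (suc d)                                                                                  ∎
        where
        smaller : ∀ {c} → v ∈ c → ∣ S ─ c ∣ ≤ k
        smaller {c} v∈c = ℕ.≤-trans
          (ℕ.s≤s⁻¹ (subst (∣ S ─ c ∣ ℕ.<_) e (p∩q≢∅⇒∣p─q∣<∣p∣ S c (v , x∈p∩q⁺ (v∈S , v∈c))))) d≤k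

_≟ᴹ_ : (q q′ : Maybe (Fin n)) → Dec (q ≡ q′)
_≟ᴹ_ = ≡-decᴹ _≟ᶠ_

child⇒parent : ∀ (p : ParentMap n) {v r} → v ∈ children p r → lookup p v ≡ just r
child⇒parent p {v} {r} v∈ = from (lookup p v ≟ᴹ just r)
  (≡-trans (≡-sym (lookup-map v (λ q → does (q ≟ᴹ just r)) p)) ([]=⇒lookup v∈))
  where
  from : ∀ {P : Set} (P? : Dec P) → does P? ≡ true → P
  from (yes p) _ = p

parent⇒child : ∀ (p : ParentMap n) {v r} → lookup p v ≡ just r → v ∈ children p r
parent⇒child p {v} {r} e = lookup⇒[]= v (children p r)
  (≡-trans (lookup-map v (λ q → does (q ≟ᴹ just r)) p) (dec-true (lookup p v ≟ᴹ just r) e))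

root-unique : ∀ (p : ParentMap n) {r r′} → IsTreeRootedAt p r → IsTreeRootedAt p r′ → r ≡ r′
root-unique p {r} {r′} (root , _) (_ , star) = from (star r)
  where
  from : Star (ChildOf p) r r′ → r ≡ r′
  from ε       = ≡-refl
  from (e ◅ _) with () ← ≡-trans (≡-sym root) e

∣p-x∣ : ∀ (p : Subset n) {x k} → x ∈ p → ∣ p ∣ ≡ suc k → ∣ p - x ∣ ≡ k
∣p-x∣ p {x} x∈p e = ℕ.suc-injective (≡-trans
  (≡-sym (≡-trans (∣p∣≡∣q∣+∣p─q∣ p ⁅ x ⁆ (λ y∈ → subst (_∈ p) (≡-sym (x∈⁅y⁆⇒x≡y x y∈)) x∈p))
    (cong (ℕ._+ ∣ p - x ∣) (∣⁅x⁆∣≡1 x)))) e)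

x∈p-y⇒x≢y : ∀ (p : Subset n) {x y} → x ∈ p - y → x ≢ y
x∈p-y⇒x≢y p {x} x∈ ≡-refl = x∈p─q⇒x∉q p ⁅ x ⁆ x∈ (x∈⁅x⁆ x)

∣p─q∣≡0⇒p⊆q : ∀ (p q : Subset n) → ∣ p ─ q ∣ ≡ 0 → p ⊆ q
∣p─q∣≡0⇒p⊆q p q e {x} x∈p with x ∈? q
... | yes x∈q = x∈q
... | no x∉q  = contradiction (subst (x ∈_) (∣p∣≡0⇒p≡∅ (p ─ q) e) (x∈p∧x∉q⇒x∈p─q x∈p x∉q)) ∉⊥

module TreeSums (𝔸 : ℚ-Algebra) where

  open Sums 𝔸
  open EGF 𝔸
  open SubsetSums 𝔸

  Σ-allFin-≡ : ∀ (w : Fin n) → Σ (allFin n) (λ v → ⟦ v ≟ᶠ w ⟧) ≈ 1#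
  Σ-allFin-suc : ∀ (f : Fin (suc n) → Carrier) → Σ (allFin (suc n)) f ≈ f zero + Σ (allFin n) (f ∘ suc)
  Σ-allFin-suc {n} f = +-congˡ
    (trans (reflexive (cong (λ vs → Σ vs f) (≡-sym (map-tabulate {n = n} id suc))))
    (Σ-map suc (allFin n) f))
  Σ-allFin-≡ {suc n} zero    = trans (Σ-allFin-suc {n} _)
    (trans (+-congˡ (Σ-zero (allFin n) (λ v → ⟦⟧-false (suc v ≟ᶠ zero) (λ ())))) (+-identityʳ 1#))
  Σ-allFin-≡ {suc n} (suc w) = trans (Σ-allFin-suc {n} _) (trans (+-identityˡ _) (trans
    (Σ-cong (allFin n) (λ v → ⟦⟧-cong (suc v ≟ᶠ suc w) (v ≟ᶠ w) (λ { ≡-refl → ≡-refl }) (cong suc)))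
      (Σ-allFin-≡ w)))

  Σ-const : ∀ {A : Set} (xs : List A) c → Σ xs (λ _ → c) ≈ ν (length xs) * c
  Σ-const []       c = sym (trans (*-congʳ ι-0) (zeroˡ c))
  Σ-const (_ ∷ xs) c = begin
    c + Σ xs (λ _ → c)            ≈⟨ +-congˡ (Σ-const xs c) ⟩
    c + ν (length xs) * c         ≈⟨ solve 2 (λ c n → c :+ n :* c := (con 1 :+ n) :* c) refl c _ ⟩
    (1# + ν (length xs)) * c      ≈⟨ *-congʳ (ν-suc (length xs)) ⟨
    ν (suc (length xs)) * c       ∎

  parentMaps : ∀ n → List (ParentMap n)
  parentMaps n = choices (replicate n (nothing ∷ map just (allFin n)))

  Σ-parentMaps-≡ : ∀ (p₀ : ParentMap n) → Σ (parentMaps n) (λ p → ⟦ ≡-decⱽ _≟ᴹ_ p p₀ ⟧) ≈ 1#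
  Σ-parentMaps-≡ {n} p₀ = Σ-choices-≡ _≟ᴹ_ (≡-decⱽ _≟ᴹ_) (replicate n parents) p₀
    (λ i → trans (reflexive (cong (λ qs → Σ qs (λ q → ⟦ q ≟ᴹ lookup p₀ i ⟧))
      (lookup-replicate i parents))) (once (lookup p₀ i)))
    where
    parents = nothing ∷ map just (allFin n)
    once : ∀ q₀ → Σ parents (λ q → ⟦ q ≟ᴹ q₀ ⟧) ≈ 1#
    once nothing  = trans (+-congˡ (trans (Σ-map just (allFin n) _) (Σ-zero (allFin n) (λ _ → refl))))
      (+-identityʳ 1#)
    once (just w) = trans (+-identityˡ _) (trans (Σ-map just (allFin n) _) (trans
      (Σ-cong (allFin n) (λ v → ⟦⟧-cong (just v ≟ᴹ just w) (v ≟ᶠ w) just-injective (cong just)))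
        (Σ-allFin-≡ w)))

  Πₛ : Subset n → (Fin n → Carrier) → Carrier
  Πₛ A f = Π (λ v → if lookup A v then f v else 1#)

  Πₛ-remove : ∀ (A : Subset n) {r} f → r ∈ A → Πₛ A f ≈ f r * Πₛ (A - r) f
  Πₛ-remove (inside ∷ A) f here = *-congˡ
    (trans (reflexive (cong (λ B → Πₛ B (f ∘ suc)) (≡-sym (p─⊥≡p A)))) (sym (*-identityˡ _)))
  Πₛ-remove (s ∷ A) {suc r} f (there r∈A) = trans (*-congˡ (Πₛ-remove A (f ∘ suc) r∈A))
    (solve 3 (λ a b c → a :* (b :* c) := b :* (a :* c)) refl _ (f (suc r)) _)

  Πₛ-one : ∀ (A : Subset n) {f} → (∀ {v} → v ∈ A → f v ≈ 1#) → Πₛ A f ≈ 1#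
  Πₛ-one A {f} e = Π-one (λ v → factor v (lookup A v) ≡-refl)
    where
    factor : ∀ v b → lookup A v ≡ b → (if b then f v else 1#) ≈ 1#
    factor v true  A∋v = e (lookup⇒[]= v A A∋v)
    factor v false _   = refl

  -- A state of the exploration of a tree from its root r₀: the children of the vertices
  -- outside A are known, U is the set of vertices whose parent p₀ is still unknown.
  module Exploration {n} (r₀ : Fin n) (x : Carrier) (T : Carrier → ℕ → Carrier)
    (T-touchard : ∀ y → IsTouchard y (T y)) where

    w : ℕ → Carrier
    w = T x

    Compatible : (U A : Subset n) (p₀ : Fin n → Maybe (Fin n)) → ParentMap n → Set
    Compatible U A p₀ p = ∀ v →
      (v ∈ U → ∃ λ u → u ∈ A × lookup p v ≡ just u) ×
      (v ∉ U → lookup p v ≡ p₀ v)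

    compatible? : ∀ U A p₀ p → Dec (Compatible U A p₀ p)
    compatible? U A p₀ p = all? (λ v →
      (v ∈? U →-dec any? (λ u → u ∈? A ×-dec lookup p v ≟ᴹ just u)) ×-dec
      (¬? (v ∈? U) →-dec lookup p v ≟ᴹ p₀ v))

    record State (U A : Subset n) (p₀ : Fin n → Maybe (Fin n)) : Set where
      field
        U⊆A       : U ⊆ A
        r₀∉U      : r₀ ∉ U
        p₀-root   : p₀ r₀ ≡ nothing
        p₀-parent : ∀ {v u} → v ∉ U → p₀ v ≡ just u → u ∉ A
        connected : ∀ p → Compatible U A p₀ p → ∀ {v} → v ∉ U → Star (ChildOf p) v r₀
    open State

    tree? : ∀ U A p₀ p → Dec (Compatible U A p₀ p × IsTreeRootedAt p r₀)
    tree? U A p₀ p = compatible? U A p₀ p ×-dec isTreeRootedAt? p r₀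

    weight : Subset n → ParentMap n → Carrier
    weight A p = Πₛ A (λ v → w ∣ children p v ∣)

    F : (U A : Subset n) → (Fin n → Maybe (Fin n)) → Carrier
    F U A p₀ = Σ (parentMaps n) (λ p → ⟦ tree? U A p₀ p ⟧ * weight A p)

    attach : Subset n → Fin n → (Fin n → Maybe (Fin n)) → Fin n → Maybe (Fin n)
    attach C r p₀ v = if does (v ∈? C) then just r else p₀ v

    attach-∈ : ∀ C r p₀ {v} → v ∈ C → attach C r p₀ v ≡ just r
    attach-∈ C r p₀ {v} v∈C with v ∈? C
    ... | yes _  = ≡-refl
    ... | no v∉C = contradiction v∈C v∉C

    attach-∉ : ∀ C r p₀ {v} → v ∉ C → attach C r p₀ v ≡ p₀ v
    attach-∉ C r p₀ {v} v∉C with v ∈? C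
    ... | yes v∈C = contradiction v∈C v∉C
    ... | no _    = ≡-refl

    F-explored : ∀ {A p₀} → State ∅ A p₀ → F ∅ A p₀ ≈ 1#
    F-explored {A} {p₀} S = begin
      Σ (parentMaps n) (λ p → ⟦ tree? ∅ A p₀ p ⟧ * weight A p)
        ≈⟨ Σ-cong (parentMaps n) (λ p → trans
          (⟦⟧-guard (tree? ∅ A p₀ p) (λ (c , _) → Πₛ-one A (leaf p c))) (*-identityʳ _)) ⟩
      Σ (parentMaps n) (λ p → ⟦ tree? ∅ A p₀ p ⟧)
        ≈⟨ Σ-cong (parentMaps n) (λ p → ⟦⟧-cong (tree? ∅ A p₀ p) (≡-decⱽ _≟ᴹ_ p (tabulateⱽ p₀))
          (λ (c , _) → unique p c) (λ { ≡-refl → c₀ , ≡-trans (lookup∘tabulate p₀ r₀) (p₀-root S) ,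
          (λ v → connected S (tabulateⱽ p₀) c₀ ∉⊥) })) ⟩
      Σ (parentMaps n) (λ p → ⟦ ≡-decⱽ _≟ᴹ_ p (tabulateⱽ p₀) ⟧)
        ≈⟨ Σ-parentMaps-≡ (tabulateⱽ p₀) ⟩
      1# ∎
      where
      c₀ : Compatible ∅ A p₀ (tabulateⱽ p₀)
      c₀ v = (λ v∈∅ → contradiction v∈∅ ∉⊥) , (λ _ → lookup∘tabulate p₀ v)
      unique : ∀ p → Compatible ∅ A p₀ p → p ≡ tabulateⱽ p₀
      unique p c = ≡-trans (≡-sym (tabulate∘lookup p)) (tabulate-cong (λ v → proj₂ (c v) ∉⊥))
      leaf : ∀ p → Compatible ∅ A p₀ p → ∀ {v} → v ∈ A → w ∣ children p v ∣ ≈ 1#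
      leaf p c {v} v∈A with ∣ children p v ∣ in e
      ... | zero  = T-touchard x .at-zero
      ... | suc _ with u , u∈ ← ∣p∣≡suc⇒Nonempty (children p v) e =
        contradiction v∈A (p₀-parent S ∉⊥ (≡-trans (≡-sym (proj₂ (c u) ∉⊥)) (child⇒parent p u∈)))

    F-unreachable : ∀ {U A p₀} → State U A p₀ → A ⊆ U → Nonempty U → F U A p₀ ≈ 0#
    F-unreachable {U} {A} {p₀} S A⊆U (v , v∈U) = Σ-zero (parentMaps n) (λ p →
      ⟦⟧-vanish (tree? U A p₀ p) (λ (c , _ , star) → r₀∉U S (stays p c (star v) v∈U)))
      where
      stays : ∀ p → Compatible U A p₀ p → ∀ {u v} → Star (ChildOf p) u v → u ∈ U → v ∈ U
      stays p c ε        u∈U = u∈U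
      stays p c (e ◅ es) u∈U with _ , u′∈A , e′ ← proj₁ (c _) u∈U =
        stays p c es (A⊆U (subst (_∈ A) (just-injective (≡-trans (≡-sym e′) e)) u′∈A))

    module _ {U A p₀} (S : State U A p₀) {r} (r∈A : r ∈ A) (r∉U : r ∉ U) where

      module _ {C} (C⊆U : C ⊆ U) p (c : Compatible (U ─ C) (A - r) (attach C r p₀) p) where

        attached : ∀ {v} → v ∈ C → lookup p v ≡ just r
        attached v∈C = ≡-trans (proj₂ (c _) (λ v∈ → x∈p─q⇒x∉q U C v∈ v∈C)) (attach-∈ C r p₀ v∈C)

        detach : Compatible U A p₀ p
        detach v = unknown , λ v∉U → ≡-trans (proj₂ (c v) (v∉U ∘ p─q⊆p U C))
          (attach-∉ C r p₀ (v∉U ∘ C⊆U))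
          where
          unknown : v ∈ U → ∃ λ u → u ∈ A × lookup p v ≡ just u
          unknown v∈U with v ∈? C
          ... | yes v∈C = r , r∈A , attached v∈C
          ... | no v∉C with u , u∈ , e ← proj₁ (c v) (x∈p∧x∉q⇒x∈p─q v∈U v∉C) = u , p─q⊆p A ⁅ r ⁆ u∈ , e

        children≡ : C ≡ children p r
        children≡ = ⊆-antisym (parent⇒child p ∘ attached) (λ {v} v∈ → from v (child⇒parent p v∈))
          where
          from : ∀ v → lookup p v ≡ just r → v ∈ C
          from v e with v ∈? C | v ∈? U
          ... | yes v∈C | _       = v∈C
          ... | no v∉C  | yes v∈U with u , u∈ , e′ ← proj₁ (c v) (x∈p∧x∉q⇒x∈p─q v∈U v∉C) =
            contradiction (just-injective (≡-trans (≡-sym e′) e)) (x∈p-y⇒x≢y A u∈)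
          from v e | no v∉C | no v∉U = contradiction r∈A
            (p₀-parent S v∉U (≡-trans (≡-sym (proj₂ (detach v) v∉U)) e))

      children⊆U : ∀ p → Compatible U A p₀ p → children p r ⊆ U
      children⊆U p c {v} v∈ with v ∈? U
      ... | yes v∈U = v∈U
      ... | no v∉U  = contradiction r∈A
        (p₀-parent S v∉U (≡-trans (≡-sym (proj₂ (c v) v∉U)) (child⇒parent p v∈)))

      attach-compatible : ∀ p → Compatible U A p₀ p →
        Compatible (U ─ children p r) (A - r) (attach (children p r) r p₀) p
      attach-compatible p c v = unknown , known
        where
        unknown : v ∈ U ─ children p r → ∃ λ u → u ∈ A - r × lookup p v ≡ just u
        unknown v∈ with u , u∈A , e ← proj₁ (c v) (p─q⊆p U (children p r) v∈) =
          u , x∈p∧x≢y⇒x∈p-y u∈A (λ { ≡-refl → x∈p─q⇒x∉q U (children p r) v∈ (parent⇒child p e) }) , e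
        known : v ∉ U ─ children p r → lookup p v ≡ attach (children p r) r p₀ v
        known v∉ with v ∈? children p r
        ... | yes v∈C = child⇒parent p v∈C
        ... | no v∉C  = proj₂ (c v) (λ v∈U → v∉ (x∈p∧x∉q⇒x∈p─q v∈U v∉C))

      attach-State : ∀ {C} → C ⊆ U → State (U ─ C) (A - r) (attach C r p₀)
      attach-State {C} C⊆U = record
        { U⊆A = λ v∈ → x∈p∧x≢y⇒x∈p-y (U⊆A S (p─q⊆p U C v∈)) (λ { ≡-refl → r∉U (p─q⊆p U C v∈) })
        ; r₀∉U = r₀∉U S ∘ p─q⊆p U C
        ; p₀-root = ≡-trans (attach-∉ C r p₀ (r₀∉U S ∘ C⊆U)) (p₀-root S)
        ; p₀-parent = parent
        ; connected = reach }
        where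
        parent : ∀ {v u} → v ∉ U ─ C → attach C r p₀ v ≡ just u → u ∉ A - r
        parent {v} v∉ e u∈ with v ∈? C
        ... | yes v∈C = x∈p-y⇒x≢y A u∈ (≡-sym (just-injective e))
        ... | no v∉C  = p₀-parent S (λ v∈U → v∉ (x∈p∧x∉q⇒x∈p─q v∈U v∉C)) e (p─q⊆p A ⁅ r ⁆ u∈)
        reach : ∀ p → Compatible (U ─ C) (A - r) (attach C r p₀) p → ∀ {v} → v ∉ U ─ C → Star
          (ChildOf p) v r₀
        reach p c {v} v∉ with v ∈? C
        ... | yes v∈C = attached C⊆U p c v∈C ◅ connected S p (detach C⊆U p c) r∉U
        ... | no v∉C  = connected S p (detach C⊆U p c) (λ v∈U → v∉ (x∈p∧x∉q⇒x∈p─q v∈U v∉C))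

      F-explore : F U A p₀ ≈ Σ (subsets n)
        (λ C → ⟦ C ⊆? U ⟧ * (w ∣ C ∣ * F (U ─ C) (A - r) (attach C r p₀)))
      F-explore = begin
        Σ maps (λ p → ⟦ tree? U A p₀ p ⟧ * weight A p)
          ≈⟨ Σ-cong maps (λ p → trans (sym (*-identityˡ _))
            (trans (*-congʳ (sym (Σ-subsets-≡ (children p r)))) (sym (Σ-*ʳ _ (subsets n) _)))) ⟩
        Σ maps (λ p → Σ (subsets n) (λ C → ⟦ C ≟ˢ children p r ⟧ * (⟦ tree? U A p₀ p ⟧ * weight A p)))
          ≈⟨ Σ-swap maps (subsets n) _ ⟩
        Σ (subsets n) (λ C → Σ maps (λ p → ⟦ C ≟ˢ children p r ⟧ * (⟦ tree? U A p₀ p ⟧ * weight A p)))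
          ≈⟨ Σ-cong (subsets n) (λ C → trans (Σ-cong maps (term C))
            (trans (Σ-*ˡ ⟦ C ⊆? U ⟧ maps _) (*-congˡ (Σ-*ˡ (w ∣ C ∣) maps _)))) ⟩
        Σ (subsets n) (λ C → ⟦ C ⊆? U ⟧ * (w ∣ C ∣ * F (U ─ C) (A - r) (attach C r p₀))) ∎
        where
        maps = parentMaps n
        _≟ˢ_ : (C D : Subset n) → Dec (C ≡ D)
        _≟ˢ_ = ≡-decⱽ _≟ᵇ_
        tree′? = λ C p → tree? (U ─ C) (A - r) (attach C r p₀) p
        term : ∀ C p → ⟦ C ≟ˢ children p r ⟧ * (⟦ tree? U A p₀ p ⟧ * weight A p) ≈
                       ⟦ C ⊆? U ⟧ * (w ∣ C ∣ * (⟦ tree′? C p ⟧ * weight (A - r) p))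
        term C p = begin
          ⟦ C ≟ˢ children p r ⟧ * (⟦ tree? U A p₀ p ⟧ * weight A p)
            ≈⟨ ⟦⟧-guard (C ≟ˢ children p r) (λ { ≡-refl → *-congˡ (Πₛ-remove A _ r∈A) }) ⟩
          ⟦ C ≟ˢ children p r ⟧ * (⟦ tree? U A p₀ p ⟧ * (w ∣ C ∣ * weight (A - r) p))
            ≈⟨ solve 4 (λ a b c d → a :* (b :* (c :* d)) := a :* b :* (c :* d)) refl ⟦ C ≟ˢ children p
              r ⟧ ⟦ tree? U A p₀ p ⟧ (w ∣ C ∣) (weight (A - r) p) ⟩
          ⟦ C ≟ˢ children p r ⟧ * ⟦ tree? U A p₀ p ⟧ * (w ∣ C ∣ * weight (A - r) p)
            ≈⟨ *-congʳ (trans (sym (⟦⟧-× (C ≟ˢ children p r) (tree? U A p₀ p))) (trans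
                 (⟦⟧-cong ((C ≟ˢ children p r) ×-dec tree? U A p₀ p) ((C ⊆? U) ×-dec tree′? C p)
                   (λ { (≡-refl , c , t) → children⊆U p c , attach-compatible p c , t })
                   (λ (C⊆U , c , t) → children≡ C⊆U p c , detach C⊆U p c , t))
                 (⟦⟧-× (C ⊆? U) (tree′? C p)))) ⟩
          ⟦ C ⊆? U ⟧ * ⟦ tree′? C p ⟧ * (w ∣ C ∣ * weight (A - r) p)
            ≈⟨ solve 4 (λ a b c d → a :* (c :* (b :* d)) := a :* b :* (c :* d)) refl ⟦ C ⊆? U ⟧ ⟦
              tree′? C p ⟧ (w ∣ C ∣) (weight (A - r) p) ⟨
          ⟦ C ⊆? U ⟧ * (w ∣ C ∣ * (⟦ tree′? C p ⟧ * weight (A - r) p)) ∎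

    F-count : ∀ N r u {U A p₀} → State U A p₀ → ∣ U ∣ ≡ u → ∣ A ∣ ≡ N → N ≡ r ℕ.+ u →
              ν N * F U A p₀ ≈ ν r * T (ν N * x) u
    F-count N r zero {U} S ∣U∣ ∣A∣ N≡ rewrite ∣p∣≡0⇒p≡∅ U ∣U∣ | ℕ.+-identityʳ r | N≡ =
      *-congˡ (trans (F-explored S) (sym (T-touchard _ .at-zero)))
    F-count N zero (suc k) {U} {A} S ∣U∣ ∣A∣ N≡ =
      trans (*-congˡ (F-unreachable S (∣p─q∣≡0⇒p⊆q A U ∣A─U∣) (∣p∣≡suc⇒Nonempty U ∣U∣)))
            (trans (zeroʳ _) (sym (trans (*-congʳ ι-0) (zeroˡ _))))
      where
      ∣A─U∣ : ∣ A ─ U ∣ ≡ 0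
      ∣A─U∣ = ℕ.+-cancelˡ-≡ ∣ U ∣ _ 0
        (≡-trans (≡-sym (∣p∣≡∣q∣+∣p─q∣ A U (U⊆A S)))
        (≡-trans ∣A∣ (≡-trans N≡ (≡-trans (≡-sym ∣U∣) (≡-sym (ℕ.+-identityʳ _))))))
    F-count (suc M) (suc ρ) (suc k) {U} {A} {p₀} S ∣U∣ ∣A∣ N≡
      with r , r∈A─U ← ∣p∣≡suc⇒Nonempty (A ─ U) {ρ}
        (ℕ.+-cancelˡ-≡ ∣ U ∣ _ (suc ρ)
        (≡-trans (≡-sym (∣p∣≡∣q∣+∣p─q∣ A U (U⊆A S)))
        (≡-trans ∣A∣ (≡-trans N≡ (≡-trans (ℕ.+-comm (suc ρ) (suc k))
        (cong (ℕ._+ suc ρ) (≡-sym ∣U∣)))))))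
      = ν-cancelˡ M {{subst ℕ.NonZero (≡-sym (≡-trans M≡ (ℕ.+-suc ρ k))) _}} (begin
      ν M * (ν (suc M) * F U A p₀)
        ≈⟨ solve 3 (λ a b c → a :* (b :* c) := b :* (a :* c)) refl (ν M) (ν (suc M)) (F U A p₀) ⟩
      ν (suc M) * (ν M * F U A p₀)
        ≈⟨ *-congˡ (trans (*-congˡ (F-explore S r∈A r∉U)) (sym (Σ-*ˡ (ν M) (subsets n) _))) ⟩
      ν (suc M) * Σ (subsets n) (λ C → ν M *
        (⟦ C ⊆? U ⟧ * (w ∣ C ∣ * F (U ─ C) (A - r) (attach C r p₀))))
        ≈⟨ *-congˡ (Σ-cong (subsets n) step) ⟩
      ν (suc M) * Σ (subsets n) (λ C → ⟦ C ⊆? U ⟧ * ((ν ρ * w ∣ C ∣ + θ w ∣ C ∣) * E ∣ U ─ C ∣))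
        ≈⟨ *-congˡ (trans (Σ-subsets-⊆ (λ c → ν ρ * w c + θ w c) E U)
          (reflexive (cong ((λ c → ν ρ * w c + θ w c) ⊛ E) ∣U∣))) ⟩
      ν (suc M) * ((λ c → ν ρ * w c + θ w c) ⊛ E) (suc k)
        ≈⟨ *-congˡ (trans (⊛-distribʳ E (λ c → ν ρ * w c) (θ w) (suc k))
          (+-congʳ (trans (⊛-scaleˡ (ν ρ) w E (suc k))
          (*-congˡ (touchard-unique W⊛E (T-touchard _) (suc k)))))) ⟩
      ν (suc M) * (ν ρ * B + (θ w ⊛ E) (suc k))
        ≈⟨ trans (distribˡ _ _ _) (+-congˡ
          (θ-touchard-⊛ (T-touchard x) (T-touchard _) x+Mx (T-touchard _) k)) ⟩
      ν (suc M) * (ν ρ * B) + ν (suc k) * B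
        ≈⟨ +-congʳ (*-congʳ (trans (ν-suc M) (+-congˡ νM≈))) ⟩
      (1# + (ν ρ + ν (suc k))) * (ν ρ * B) + ν (suc k) * B
        ≈⟨ solve 3 (λ ρ u b → (con 1 :+ (ρ :+ u)) :* (ρ :* b) :+ u :* b := (ρ :+ u) :*
          ((con 1 :+ ρ) :* b)) refl (ν ρ) (ν (suc k)) B ⟩
      (ν ρ + ν (suc k)) * ((1# + ν ρ) * B)
        ≈⟨ *-cong νM≈ (*-congʳ (ν-suc ρ)) ⟨
      ν M * (ν (suc ρ) * B) ∎)
      where
      E : ℕ → Carrier
      E = T (ν M * x)
      B = T (ν (suc M) * x) (suc k)
      r∈A = p─q⊆p A U r∈A─U
      r∉U = x∈p─q⇒x∉q A U r∈A─U
      M≡ : M ≡ ρ ℕ.+ suc k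
      M≡ = ℕ.suc-injective N≡
      νM≈ : ν M ≈ ν ρ + ν (suc k)
      νM≈ = trans (reflexive (cong ν M≡)) (ν-+ ρ (suc k))
      x+Mx : x + ν M * x ≈ ν (suc M) * x
      x+Mx = sym (trans (*-congʳ (ν-suc M)) (trans (distribʳ x 1# (ν M)) (+-congʳ (*-identityˡ x))))
      W⊛E : IsTouchard (ν (suc M) * x) (w ⊛ E)
      W⊛E = touchard-cong x+Mx (touchard-⊛ (T-touchard x) (T-touchard _))
      step : ∀ C → ν M * (⟦ C ⊆? U ⟧ * (w ∣ C ∣ * F (U ─ C) (A - r) (attach C r p₀))) ≈
                   ⟦ C ⊆? U ⟧ * ((ν ρ * w ∣ C ∣ + θ w ∣ C ∣) * E ∣ U ─ C ∣)
      step C = trans (solve 4 (λ m i a f → m :* (i :* (a :* f)) := i :* (a :* (m :* f))) refl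
        (ν M) ⟦ C ⊆? U ⟧ (w ∣ C ∣) _)
        (⟦⟧-guard (C ⊆? U) (λ C⊆U → begin
          w ∣ C ∣ * (ν M * F (U ─ C) (A - r) (attach C r p₀))
            ≈⟨ *-congˡ (F-count M (ρ ℕ.+ ∣ C ∣) ∣ U ─ C ∣ (attach-State S r∈A r∉U C⊆U) ≡-refl
              (∣p-x∣ A r∈A ∣A∣)
                 (≡-trans M≡ (≡-trans (cong (ρ ℕ.+_) (≡-trans (≡-sym ∣U∣) (∣p∣≡∣q∣+∣p─q∣ U C C⊆U)))
                   (≡-sym (ℕ.+-assoc ρ ∣ C ∣ _))))) ⟩
          w ∣ C ∣ * (ν (ρ ℕ.+ ∣ C ∣) * E ∣ U ─ C ∣)
            ≈⟨ *-congˡ (*-congʳ (ν-+ ρ ∣ C ∣)) ⟩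
          w ∣ C ∣ * ((ν ρ + ν ∣ C ∣) * E ∣ U ─ C ∣)
            ≈⟨ solve 4 (λ a r c e → a :* ((r :+ c) :* e) := (r :* a :+ c :* a) :* e) refl (w ∣ C ∣)
              (ν ρ) (ν ∣ C ∣) (E ∣ U ─ C ∣) ⟩
          (ν ρ * w ∣ C ∣ + θ w ∣ C ∣) * E ∣ U ─ C ∣ ∎))

    initial-State : State (∁ ⁅ r₀ ⁆) ⊤ (λ _ → nothing)
    initial-State = record
      { U⊆A = λ _ → ∈⊤
      ; r₀∉U = x∈p⇒x∉∁p (x∈⁅x⁆ r₀)
      ; p₀-root = ≡-refl
      ; p₀-parent = λ _ ()
      ; connected = λ p c {v} v∉ → subst (λ u → Star (ChildOf p) u r₀)
        (≡-sym (x∈⁅y⁆⇒x≡y r₀ (x∉∁p⇒x∈p v∉))) ε }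

    tree⇒initial : ∀ p → IsTreeRootedAt p r₀ → Compatible (∁ ⁅ r₀ ⁆) ⊤ (λ _ → nothing) p
    tree⇒initial p (root , star) v = (λ v∈ → parent (x∈∁p⇒x∉p v∈) (star v)) ,
      (λ v∉ → ≡-trans (cong (lookup p) (x∈⁅y⁆⇒x≡y r₀ (x∉∁p⇒x∈p v∉))) root)
      where
      parent : v ∉ ⁅ r₀ ⁆ → Star (ChildOf p) v r₀ → ∃ λ u → u ∈ ⊤ × lookup p v ≡ just u
      parent v≢ ε       = contradiction (x∈⁅x⁆ r₀) v≢
      parent v≢ (e ◅ _) = _ , ∈⊤ , e

  module _ (x : Carrier) (T : Carrier → ℕ → Carrier) (T-touchard : ∀ y → IsTouchard y (T y)) where

    Σ-isTreeRootedAt : ∀ (p : ParentMap n) → ⟦ isRootedTree? p ⟧ ≈ Σ (allFin n)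
      (λ r → ⟦ isTreeRootedAt? p r ⟧)
    Σ-isTreeRootedAt {n} p with isRootedTree? p
    ... | yes (r , tree) = sym
      (trans (Σ-cong (allFin n) (λ r′ → ⟦⟧-cong (isTreeRootedAt? p r′) (r′ ≟ᶠ r)
      (λ tree′ → root-unique p tree′ tree) (λ { ≡-refl → tree }))) (Σ-allFin-≡ r))
    ... | no ¬tree       = sym
      (Σ-zero (allFin n) (λ r → ⟦⟧-false (isTreeRootedAt? p r) (λ tree → ¬tree (r , tree))))

    Σ-enrichedTrees : ∀ m → Σ (enrichedTrees (suc m)) (λ t → x ^ blocks t) ≈ T (ν (suc m) * x) m
    Σ-enrichedTrees m = begin
      Σ (enrichedTrees N) (λ t → x ^ blocks t)
        ≈⟨ Σ-concatMap _ (rootedTrees N) _ ⟩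
      Σ (rootedTrees N) (λ p → Σ (map (p ,_) (partitions p)) (λ t → x ^ blocks t))
        ≈⟨ Σ-cong (rootedTrees N) (λ p → trans (Σ-map (p ,_) (partitions p) _)
          (trans (Σ-choices-^ x length (λ v → setPartitions (children p v)))
          (Π-cong (λ v → Σ-setPartitions x (T-touchard x) (children p v))))) ⟩
      Σ (rootedTrees N) (λ p → Π (λ v → T x ∣ children p v ∣))
        ≈⟨ Σ-filter isRootedTree? (parentMaps N) _ ⟩
      Σ (parentMaps N) (λ p → ⟦ isRootedTree? p ⟧ * Π (λ v → T x ∣ children p v ∣))
        ≈⟨ Σ-cong (parentMaps N) (λ p → trans (*-congʳ (Σ-isTreeRootedAt p))
          (sym (Σ-*ʳ _ (allFin N) _))) ⟩
      Σ (parentMaps N) (λ p → Σ (allFin N)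
        (λ r → ⟦ isTreeRootedAt? p r ⟧ * Π (λ v → T x ∣ children p v ∣)))
        ≈⟨ Σ-swap (parentMaps N) (allFin N) _ ⟩
      Σ (allFin N) (λ r → Σ (parentMaps N)
        (λ p → ⟦ isTreeRootedAt? p r ⟧ * Π (λ v → T x ∣ children p v ∣)))
        ≈⟨ Σ-cong (allFin N) (λ r → Σ-cong (parentMaps N) (λ p → *-cong
             (⟦⟧-cong (isTreeRootedAt? p r) (tree? r _ _ _ p) (λ t → tree⇒initial r p t , t) proj₂)
             (Π-cong (λ v → reflexive (cong (if_then T x ∣ children p v ∣ else 1#)
               (≡-sym (lookup-replicate v inside))))))) ⟩
      Σ (allFin N) F₀
        ≈⟨ ν-cancelˡ N total ⟩
      T (ν N * x) m ∎
      where
      N = suc m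
      open module Expl (r : Fin N) = Exploration r x T T-touchard using
        (tree?; tree⇒initial; initial-State; F-count; F)
      partitions : ParentMap N → List _
      partitions p = choices (tabulateⱽ (λ v → setPartitions (children p v)))
      F₀ : Fin N → Carrier
      F₀ r = F r (∁ ⁅ r ⁆) ⊤ (λ _ → nothing)
      total : ν N * Σ (allFin N) F₀ ≈ ν N * T (ν N * x) m
      total = begin
        ν N * Σ (allFin N) F₀
          ≈⟨ Σ-*ˡ (ν N) (allFin N) F₀ ⟨
        Σ (allFin N) (λ r → ν N * F₀ r)
          ≈⟨ Σ-cong (allFin N) (λ r → trans
            (F-count r N 1 m (initial-State r) (≡-trans (∣∁p∣≡n∸∣p∣ ⁅ r ⁆) (cong (N ∸_) (∣⁅x⁆∣≡1 r)))
            (∣⊤∣≡n N) ≡-refl) (trans (*-congʳ ι-1) (*-identityˡ _))) ⟩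
        Σ (allFin N) (λ r → T (ν N * x) m)
          ≈⟨ Σ-const (allFin N) _ ⟩
        ν (length (allFin N)) * T (ν N * x) m
          ≡⟨ cong (λ k → ν k * T (ν N * x) m) (length-tabulate {n = N} id) ⟩
        ν N * T (ν N * x) m ∎

module Exponential (𝔸 : ℚ-Algebra) where

  open Sums 𝔸
  open EGF 𝔸

  ν1* : ∀ a → ν 1 * a ≈ a
  ν1* a = trans (*-congʳ ι-1) (*-identityˡ a)

  ν-* : ∀ m n → ν (m ℕ.* n) ≈ ν m * ν n
  ν-* zero    n = trans ι-0 (sym (trans (*-congʳ ι-0) (zeroˡ (ν n))))
  ν-* (suc m) n = begin
    ν (n ℕ.+ m ℕ.* n)     ≈⟨ ν-+ n (m ℕ.* n) ⟩
    ν n + ν (m ℕ.* n)     ≈⟨ +-congˡ (ν-* m n) ⟩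
    ν n + ν m * ν n       ≈⟨ solve 2 (λ m n → n :+ m :* n := (con 1 :+ m) :* n) refl (ν m) (ν n) ⟩
    (1# + ν m) * ν n      ≈⟨ *-congʳ (ν-suc m) ⟨
    ν (suc m) * ν n       ∎

  S : ℕ → (ℕ → Carrier) → Carrier
  S n h = foldr _+_ 0# (applyUpTo h n)

  S-cong : ∀ n {h h′} → (∀ k → h k ≈ h′ k) → S n h ≈ S n h′
  S-cong zero    e = refl
  S-cong (suc n) e = +-cong (e 0) (S-cong n (e ∘ suc))

  S-*ˡ : ∀ c n h → S n (λ k → c * h k) ≈ c * S n h
  S-*ˡ c zero    h = sym (zeroʳ c)
  S-*ˡ c (suc n) h = trans (+-congˡ (S-*ˡ c n (h ∘ suc))) (sym (distribˡ c _ _))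

  S-zero : ∀ n {h} → (∀ k → h k ≈ 0#) → S n h ≈ 0#
  S-zero zero    e = refl
  S-zero (suc n) e = trans (+-cong (e 0) (S-zero n (e ∘ suc))) (+-identityˡ 0#)

  S-extend : ∀ {m n} h → m ≤ n → (∀ k → m ≤ k → h k ≈ 0#) → S n h ≈ S m h
  S-extend {n = n} h z≤n e = S-zero n (λ k → e k z≤n)
  S-extend h (s≤s m≤n)   e = +-congˡ (S-extend (h ∘ suc) m≤n (λ k → e (suc k) ∘ s≤s))

  ⊛-zeroʳ : ∀ f d → (f ⊛ (λ _ → 0#)) d ≈ 0#
  ⊛-zeroʳ f zero    = zeroʳ (f 0)
  ⊛-zeroʳ f (suc d) = trans (+-cong (⊛-zeroʳ (f ∘ suc) d) (⊛-zeroʳ f d)) (+-identityˡ 0#)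

  ⊛-S : ∀ n f (g : ℕ → ℕ → Carrier) d → (f ⊛ (λ i → S n (λ k → g k i))) d ≈ S n (λ k → (f ⊛ g k) d)
  ⊛-S zero    f g d = ⊛-zeroʳ f d
  ⊛-S (suc n) f g d = trans (⊛-distribˡ f (g 0) _ d) (+-congˡ (⊛-S n f (g ∘ suc) d))

  δ : ℕ → Carrier
  δ zero    = 1#
  δ (suc _) = 0#

  ⊛-identityˡ : ∀ g d → (δ ⊛ g) d ≈ g d
  ⊛-identityˡ g zero    = *-identityˡ (g 0)
  ⊛-identityˡ g (suc d) = trans (+-cong (trans (⊛-comm _ g d) (⊛-zeroʳ g d)) (⊛-identityˡ (g ∘ suc) d))
    (+-identityˡ _)

  pow : (ℕ → Carrier) → ℕ → ℕ → Carrier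
  pow h zero    = δ
  pow h (suc k) = h ⊛ pow h k

  pow-deriv : ∀ h k d → pow h (suc k) (suc d) ≈ ν (suc k) * ((h ∘ suc) ⊛ pow h k) d
  pow-deriv h zero d = begin
    ((h ∘ suc) ⊛ δ) d + (h ⊛ (λ _ → 0#)) d        ≈⟨ +-congˡ (⊛-zeroʳ h d) ⟩
    ((h ∘ suc) ⊛ δ) d + 0#                        ≈⟨ +-identityʳ _ ⟩
    ((h ∘ suc) ⊛ δ) d                             ≈⟨ trans (*-congʳ ι-1) (*-identityˡ _) ⟨
    ν 1 * ((h ∘ suc) ⊛ δ) d                       ∎
  pow-deriv h (suc k) d = begin
    (h′ ⊛ pow h (suc k)) d + (h ⊛ (pow h (suc k) ∘ suc)) d
      ≈⟨ +-congˡ (⊛-cong d (λ _ → refl) (pow-deriv h k)) ⟩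
    (h′ ⊛ pow h (suc k)) d + (h ⊛ (λ i → ν (suc k) * (h′ ⊛ pow h k) i)) d
      ≈⟨ +-congˡ (trans (⊛-scaleʳ (ν (suc k)) h _ d) (*-congˡ exchange)) ⟩
    (h′ ⊛ pow h (suc k)) d + ν (suc k) * (h′ ⊛ pow h (suc k)) d
      ≈⟨ solve 2 (λ n a → a :+ n :* a := (con 1 :+ n) :* a) refl (ν (suc k)) _ ⟩
    (1# + ν (suc k)) * (h′ ⊛ pow h (suc k)) d                                 ≈⟨ *-congʳ
      (ν-suc (suc k)) ⟨
    ν (suc (suc k)) * (h′ ⊛ pow h (suc k)) d                                  ∎
    where
    h′ = h ∘ suc
    exchange : (h ⊛ (h′ ⊛ pow h k)) d ≈ (h′ ⊛ (h ⊛ pow h k)) d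
    exchange = trans (sym (⊛-assoc h h′ (pow h k) d))
      (trans (⊛-cong d (⊛-comm h h′) (λ _ → refl)) (⊛-assoc h′ h (pow h k) d))

  pow-< : ∀ {h} → h 0 ≈ 0# → ∀ k d → d < k → pow h k d ≈ 0#
  pow-< h₀ (suc k) zero    _         = trans (*-congʳ h₀) (zeroˡ _)
  pow-< {h} h₀ (suc k) (suc d) (s≤s d<k) = begin
    pow h (suc k) (suc d)                      ≈⟨ pow-deriv h k d ⟩
    ν (suc k) * ((h ∘ suc) ⊛ pow h k) d
      ≈⟨ *-congˡ (⊛-cong-≤ d (λ _ _ → refl) (λ i i≤d → pow-< h₀ k i (ℕ.≤-<-trans i≤d d<k))) ⟩
    ν (suc k) * ((h ∘ suc) ⊛ (λ _ → 0#)) d     ≈⟨ *-congˡ (⊛-zeroʳ (h ∘ suc) d) ⟩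
    ν (suc k) * 0#                             ≈⟨ zeroʳ _ ⟩
    0#                                         ∎

  1/! : ℕ → Carrier
  1/! k = ι (1/ k !)

  k!*1/k! : ∀ k → ν (k !) * 1/! k ≈ 1#
  k!*1/k! k = trans (*-comm _ _)
    (trans (sym (ι-* (1/ k !) (fromℕ (k !)))) (trans (ι-cong (1/n*n≡1 (k !) {{k ℕ.!≢0}})) ι-1))

  ν-! : ∀ k → ν (suc k !) ≈ ν (k !) * ν (suc k)
  ν-! k = trans (ν-* (suc k) (k !)) (*-comm _ _)

  1/!-suc : ∀ k → 1/! (suc k) * ν (suc k) ≈ 1/! k
  1/!-suc k = ν-cancelˡ (k !) {{k ℕ.!≢0}} (begin
    ν (k !) * (1/! (suc k) * ν (suc k))    ≈⟨ solve 3
      (λ a b c → a :* (b :* c) := a :* c :* b) refl _ _ _ ⟩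
    ν (k !) * ν (suc k) * 1/! (suc k)      ≈⟨ *-congʳ (ν-! k) ⟨
    ν (suc k !) * 1/! (suc k)              ≈⟨ k!*1/k! (suc k) ⟩
    1#                                     ≈⟨ k!*1/k! k ⟨
    ν (k !) * 1/! k                        ∎)

  expₑ : (ℕ → Carrier) → ℕ → Carrier
  expₑ h d = S (suc d) (λ k → 1/! k * pow h k d)

  expₑ-zero : ∀ h → expₑ h 0 ≈ 1#
  expₑ-zero h = trans (+-identityʳ _)
    (trans (*-identityʳ _) (trans (sym (*-identityˡ _)) (trans (*-congʳ (sym ι-1)) (k!*1/k! 0))))

  expₑ-deriv : ∀ {h} → h 0 ≈ 0# → ∀ d → expₑ h (suc d) ≈ ((h ∘ suc) ⊛ expₑ h) d
  expₑ-deriv {h} h₀ d = begin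
    1/! 0 * 0# + S (suc d) (λ k → 1/! (suc k) * pow h (suc k) (suc d))
      ≈⟨ trans (+-congʳ (zeroʳ _)) (+-identityˡ _) ⟩
    S (suc d) (λ k → 1/! (suc k) * pow h (suc k) (suc d))
      ≈⟨ S-cong (suc d) (λ k → trans (*-congˡ (pow-deriv h k d))
        (trans (sym (*-assoc _ _ _)) (*-congʳ (1/!-suc k)))) ⟩
    S (suc d) (λ k → 1/! k * ((h ∘ suc) ⊛ pow h k) d)
      ≈⟨ S-cong (suc d) (λ k → ⊛-scaleʳ (1/! k) (h ∘ suc) (pow h k) d) ⟨
    S (suc d) (λ k → ((h ∘ suc) ⊛ (λ i → 1/! k * pow h k i)) d)
      ≈⟨ ⊛-S (suc d) (h ∘ suc) (λ k i → 1/! k * pow h k i) d ⟨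
    ((h ∘ suc) ⊛ (λ i → S (suc d) (λ k → 1/! k * pow h k i))) d
      ≈⟨ ⊛-cong-≤ d (λ _ _ → refl)
        (λ i i≤d → S-extend (λ k → 1/! k * pow h k i) (s≤s i≤d)
        (λ k i<k → trans (*-congˡ (pow-< {h} h₀ k i i<k)) (zeroʳ _))) ⟩
    ((h ∘ suc) ⊛ expₑ h) d ∎

  expₑ-≈𝟙 : ∀ {h} → h 0 ≈ 0# → (∀ d → h (suc d) ≈ δ d) → ∀ d → expₑ h d ≈ 1#
  expₑ-≈𝟙 {h} h₀ h′ zero    = expₑ-zero h
  expₑ-≈𝟙 {h} h₀ h′ (suc d) = begin
    expₑ h (suc d)              ≈⟨ expₑ-deriv h₀ d ⟩
    ((h ∘ suc) ⊛ expₑ h) d      ≈⟨ ⊛-cong d h′ (λ _ → refl) ⟩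
    (δ ⊛ expₑ h) d              ≈⟨ ⊛-identityˡ (expₑ h) d ⟩
    expₑ h d                    ≈⟨ expₑ-≈𝟙 h₀ h′ d ⟩
    1#                          ∎

  expₑ-touchard : ∀ {y h} → h 0 ≈ 0# → (∀ d → h (suc d) ≈ y) → IsTouchard y (expₑ h)
  expₑ-touchard {y} {h} h₀ h′ .at-zero  = expₑ-zero h
  expₑ-touchard {y} {h} h₀ h′ .at-suc d = begin
    expₑ h (suc d)                    ≈⟨ expₑ-deriv h₀ d ⟩
    ((h ∘ suc) ⊛ expₑ h) d            ≈⟨ ⊛-cong d (λ i → trans (h′ i) (sym (*-identityʳ y)))
      (λ _ → refl) ⟩
    ((λ _ → y * 1#) ⊛ expₑ h) d       ≈⟨ ⊛-scaleˡ y 𝟙 (expₑ h) d ⟩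
    y * (𝟙 ⊛ expₑ h) d                ∎

  cauchy : (f g : ℕ → Carrier) → ℕ → Carrier
  cauchy f g zero    = f 0 * g 0
  cauchy f g (suc m) = f 0 * g (suc m) + cauchy (f ∘ suc) g m

  S-cauchy : ∀ f g m → S (suc m) (λ i → f i * g (m ∸ i)) ≈ cauchy f g m
  S-cauchy f g zero    = +-identityʳ _
  S-cauchy f g (suc m) = +-congˡ (S-cauchy (f ∘ suc) g m)

  cauchy-congˡ : ∀ {f f′} g m → (∀ i → f i ≈ f′ i) → cauchy f g m ≈ cauchy f′ g m
  cauchy-congˡ g zero    e = *-congʳ (e 0)
  cauchy-congˡ g (suc m) e = +-cong (*-congʳ (e 0)) (cauchy-congˡ g m (e ∘ suc))

  cauchy-distribʳ : ∀ f f′ g m → cauchy (λ i → f i + f′ i) g m ≈ cauchy f g m + cauchy f′ g m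
  cauchy-distribʳ f f′ g zero    = distribʳ (g 0) (f 0) (f′ 0)
  cauchy-distribʳ f f′ g (suc m) = trans (+-congˡ (cauchy-distribʳ (f ∘ suc) (f′ ∘ suc) g m))
    (solve 5 (λ a b c d e → (a :+ b) :* c :+ (d :+ e) := (a :* c :+ d) :+ (b :* c :+ e)) refl (f 0)
      (f′ 0) (g (suc m)) _ _)

  cauchy-sucʳ : ∀ f g m → cauchy f g (suc m) ≈ cauchy f (g ∘ suc) m + f (suc m) * g 0
  cauchy-sucʳ f g zero    = refl
  cauchy-sucʳ f g (suc m) = trans (+-congˡ (cauchy-sucʳ (f ∘ suc) g m)) (sym (+-assoc _ _ _))

  θ-suc : ∀ f i → θ f (suc i) ≈ f (suc i) + θ (f ∘ suc) i
  θ-suc f i = trans (*-congʳ (ν-suc i))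
    (solve 2 (λ n a → (con 1 :+ n) :* a := a :+ n :* a) refl (ν i) (f (suc i)))

  θ-zero : ∀ f → θ f 0 ≈ 0#
  θ-zero f = trans (*-congʳ ι-0) (zeroˡ _)

  θ-cauchy : ∀ f g m → ν m * cauchy f g m ≈ cauchy (θ f) g m + cauchy f (θ g) m
  θ-cauchy f g zero = begin
    ν 0 * (f 0 * g 0)                      ≈⟨ trans (*-congʳ ι-0) (zeroˡ _) ⟩
    0#                                     ≈⟨ +-identityˡ 0# ⟨
    0# + 0#
      ≈⟨ +-cong (trans (*-congʳ (θ-zero f)) (zeroˡ _)) (trans (*-congˡ (θ-zero g)) (zeroʳ _)) ⟨
    θ f 0 * g 0 + f 0 * θ g 0              ∎
  θ-cauchy f g (suc m) = begin
    ν (suc m) * (f 0 * g (suc m) + cauchy f′ g m)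
      ≈⟨ solve 4 (λ n a b c → n :* (a :* b :+ c) := a :* (n :* b) :+ n :* c) refl (ν (suc m)) (f 0)
        (g (suc m)) _ ⟩
    f 0 * θ g (suc m) + ν (suc m) * cauchy f′ g m
      ≈⟨ +-congˡ (trans (*-congʳ (ν-suc m))
        (trans (distribʳ _ _ _) (+-cong (*-identityˡ _) (θ-cauchy f′ g m)))) ⟩
    f 0 * θ g (suc m) + (cauchy f′ g m + (cauchy (θ f′) g m + cauchy f′ (θ g) m))
      ≈⟨ solve 4 (λ a b c d → a :+ (b :+ (c :+ d)) := (b :+ c) :+ (a :+ d)) refl _ _ _ _ ⟩
    cauchy f′ g m + cauchy (θ f′) g m + cauchy f (θ g) (suc m)
      ≈⟨ +-congʳ (trans (cauchy-congˡ g m (θ-suc f)) (cauchy-distribʳ f′ (θ f′) g m)) ⟨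
    cauchy (θ f ∘ suc) g m + cauchy f (θ g) (suc m)
      ≈⟨ +-congʳ (trans (+-congʳ (trans (*-congʳ (θ-zero f)) (zeroˡ _))) (+-identityˡ _)) ⟨
    cauchy (θ f) g (suc m) + cauchy f (θ g) (suc m) ∎
    where f′ = f ∘ suc

  -- Passage from the coefficients of tᵐ to those of tᵐ/m!.
  hat : (ℕ → Carrier) → ℕ → Carrier
  hat f m = ν (m !) * f m

  hat-cong : ∀ {f g} m → f m ≈ g m → hat f m ≈ hat g m
  hat-cong m e = *-congˡ e

  hat-θ : ∀ f i → hat (θ f ∘ suc) i ≈ hat f (suc i)
  hat-θ f i = trans (sym (*-assoc _ _ _)) (*-congʳ (sym (ν-! i)))

  hat-cauchy : ∀ f g m → hat (cauchy f g) m ≈ (hat f ⊛ hat g) m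
  hat-cauchy f g zero = trans (ν1* _) (sym (*-cong (ν1* (f 0)) (ν1* (g 0))))
  hat-cauchy f g (suc m) = begin
    ν (suc m !) * cauchy f g (suc m)
      ≈⟨ trans (*-congʳ (ν-! m)) (*-assoc _ _ _) ⟩
    ν (m !) * (ν (suc m) * cauchy f g (suc m))
      ≈⟨ trans (*-congˡ (θ-cauchy f g (suc m))) (distribˡ _ _ _) ⟩
    ν (m !) * cauchy (θ f) g (suc m) + ν (m !) * cauchy f (θ g) (suc m)
      ≈⟨ +-cong (*-congˡ (trans (+-congʳ (trans (*-congʳ (θ-zero f)) (zeroˡ _))) (+-identityˡ _)))
                (*-congˡ (trans (cauchy-sucʳ f (θ g) m)
                  (trans (+-congˡ (trans (*-congˡ (θ-zero g)) (zeroʳ _))) (+-identityʳ _)))) ⟩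
    hat (cauchy (θ f ∘ suc) g) m + hat (cauchy f (θ g ∘ suc)) m
      ≈⟨ +-cong (hat-cauchy (θ f ∘ suc) g m) (hat-cauchy f (θ g ∘ suc) m) ⟩
    (hat (θ f ∘ suc) ⊛ hat g) m + (hat f ⊛ hat (θ g ∘ suc)) m
      ≈⟨ +-cong (⊛-cong m (hat-θ f) (λ _ → refl)) (⊛-cong m (λ _ → refl) (hat-θ g)) ⟩
    (hat f ⊛ hat g) (suc m) ∎

module _ where

  open Sums polynomialAlgebra
  open EGF polynomialAlgebra
  open Exponential polynomialAlgebra

  hat-^ˢ : ∀ f k m → hat (f ^ˢ k) m ≈ pow (hat f) k m
  hat-^ˢ f zero    zero    = ν1* 1#
  hat-^ˢ f zero    (suc m) = zeroʳ (ν (suc m !))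
  hat-^ˢ f (suc k) m       = begin
    hat (f *ˢ f ^ˢ k) m
      ≈⟨ hat-cong {f *ˢ f ^ˢ k} {cauchy f (f ^ˢ k)} m (S-cauchy f (f ^ˢ k) m) ⟩
    hat (cauchy f (f ^ˢ k)) m          ≈⟨ hat-cauchy f (f ^ˢ k) m ⟩
    (hat f ⊛ hat (f ^ˢ k)) m           ≈⟨ ⊛-cong m (λ _ → refl) (hat-^ˢ f k) ⟩
    (hat f ⊛ pow (hat f) k) m          ∎

  hat-exp : ∀ f m → hat (exp f) m ≈ expₑ (hat f) m
  hat-exp f m = begin
    ν (m !) * S (suc m) (λ k → 1/ k ! ·ᴾ (f ^ˢ k) m)
      ≈⟨ S-*ˡ (ν (m !)) (suc m) (λ k → 1/ k ! ·ᴾ (f ^ˢ k) m) ⟨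
    S (suc m) (λ k → ν (m !) * (1/ k ! ·ᴾ (f ^ˢ k) m))
      ≈⟨ S-cong (suc m) {λ k → ν (m !) * (1/ k ! ·ᴾ (f ^ˢ k) m)} {λ k → 1/! k * pow (hat f) k m} term ⟩
    expₑ (hat f) m                                             ∎
    where
    term : ∀ k → ν (m !) * (1/ k ! ·ᴾ (f ^ˢ k) m) ≈ 1/! k * pow (hat f) k m
    term k = begin
      ν (m !) * (1/ k ! ·ᴾ (f ^ˢ k) m)   ≈⟨ *-congˡ {ν (m !)} (·ᴾ≋*ᴾ (1/ k !) ((f ^ˢ k) m)) ⟩
      ν (m !) * (1/! k * (f ^ˢ k) m)
        ≈⟨ solve 3 (λ a b c → a :* (b :* c) := b :* (a :* c)) refl (ν (m !)) (1/! k) ((f ^ˢ k) m) ⟩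
      1/! k * hat (f ^ˢ k) m             ≈⟨ *-congˡ {1/! k} (hat-^ˢ f k m) ⟩
      1/! k * pow (hat f) k m            ∎

  hat-exp-t : ∀ m → hat (exp t) m ≈ 1#
  hat-exp-t m = trans (hat-exp t m) (expₑ-≈𝟙 (zeroʳ (ν 1)) deriv m)
    where
    deriv : ∀ d → hat t (suc d) ≈ δ d
    deriv zero    = ν1* 1#
    deriv (suc d) = zeroʳ (ν (suc (suc d) !))

  touchard-isTouchard : IsTouchard X touchard
  touchard-isTouchard = record
    { at-zero  = trans (via 0) (E .at-zero)
    ; at-suc   = λ d → trans (via (suc d))
      (trans (E .at-suc d) (*-congˡ {X} (⊛-cong d (λ _ → refl) (λ i → sym (via i))))) }
    where
    f : Series
    f = X ·ˢ (exp t -ˢ 1ˢ)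
    h₀ : hat f 0 ≈ 0#
    h₀ = begin
      ν 1 * (X * (exp t 0 + (ℚ.- 1ℚ) ·ᴾ 1#))   ≈⟨ ν1* _ ⟩
      X * (exp t 0 + (ℚ.- 1ℚ) ·ᴾ 1#)
        ≈⟨ *-congˡ {X} (+-congʳ {(ℚ.- 1ℚ) ·ᴾ 1#} (trans (sym (ν1* (exp t 0))) (hat-exp-t 0))) ⟩
      X * (1# + (ℚ.- 1ℚ) ·ᴾ 1#)                ≈⟨ *-congˡ {X} 0∷[]≋[] ⟩
      X * 0#                                   ≈⟨ zeroʳ X ⟩
      0#                                       ∎
    h′ : ∀ d → hat f (suc d) ≈ X
    h′ d = begin
      ν (suc d !) * (X * (exp t (suc d) + 0#))
        ≈⟨ *-congˡ {ν (suc d !)} (*-congˡ {X} (+-identityʳ (exp t (suc d)))) ⟩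
      ν (suc d !) * (X * exp t (suc d))
        ≈⟨ solve 3 (λ a b c → a :* (b :* c) := b :* (a :* c)) refl (ν (suc d !)) X (exp t (suc d)) ⟩
      X * hat (exp t) (suc d)                    ≈⟨ *-congˡ {X} (hat-exp-t (suc d)) ⟩
      X * 1#                                     ≈⟨ *-identityʳ X ⟩
      X                                          ∎
    E : IsTouchard X (expₑ (hat f))
    E = expₑ-touchard h₀ h′
    via : ∀ m → touchard m ≈ expₑ (hat f) m
    via m = trans (·ᴾ≋*ᴾ (fromℕ (m !)) (exp f m)) (hat-exp f m)

module Horner (𝔸 : ℚ-Algebra) where

  open Sums 𝔸
  open EGF 𝔸
  module Poly = EGF polynomialAlgebra

  horner : Polynomial → Carrier → Carrier
  horner []      y = 0#
  horner (a ∷ p) y = ι a + y * horner p y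

  module _ (y : Carrier) where

    horner-zero : ∀ p → p ≋ [] → horner p y ≈ 0#
    horner-zero []      e = refl
    horner-zero (a ∷ p) e = begin
      ι a + y * horner p y
        ≈⟨ +-cong (trans (ι-cong (e .at 0)) ι-0) (*-congˡ (horner-zero p (mk≋ (e .at ∘ suc)))) ⟩
      0# + y * 0#             ≈⟨ trans (+-identityˡ _) (zeroʳ y) ⟩
      0#                      ∎

    horner-cong : ∀ p q → p ≋ q → horner p y ≈ horner q y
    horner-cong []      q       e = sym (horner-zero q (≋-sym e))
    horner-cong (a ∷ p) []      e = horner-zero (a ∷ p) e
    horner-cong (a ∷ p) (b ∷ q) e = +-cong (ι-cong (e .at 0))
      (*-congˡ (horner-cong p q (mk≋ (e .at ∘ suc))))

    horner-+ : ∀ p q → horner (p +ᴾ q) y ≈ horner p y + horner q y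
    horner-+ []      q       = sym (+-identityˡ _)
    horner-+ (a ∷ p) []      = sym (+-identityʳ _)
    horner-+ (a ∷ p) (b ∷ q) = trans (+-cong (ι-+ a b) (*-congˡ (horner-+ p q)))
      (solve 5 (λ a b y p q → (a :+ b) :+ y :* (p :+ q) := (a :+ y :* p) :+ (b :+ y :* q)) refl (ι a)
        (ι b) y _ _)

    horner-· : ∀ c p → horner (c ·ᴾ p) y ≈ ι c * horner p y
    horner-· c []      = sym (zeroʳ _)
    horner-· c (a ∷ p) = trans (+-cong (ι-* c a) (*-congˡ (horner-· c p)))
      (solve 4 (λ c a y p → c :* a :+ y :* (c :* p) := c :* (a :+ y :* p)) refl (ι c) (ι a) y _)

    horner-* : ∀ p q → horner (p *ᴾ q) y ≈ horner p y * horner q y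
    horner-* []      q = sym (zeroˡ _)
    horner-* (a ∷ p) q = begin
      horner (a ·ᴾ q +ᴾ (0ℚ ∷ p *ᴾ q)) y                       ≈⟨ horner-+ (a ·ᴾ q) _ ⟩
      horner (a ·ᴾ q) y + (ι 0ℚ + y * horner (p *ᴾ q) y)
        ≈⟨ +-cong (horner-· a q) (+-cong ι-0 (*-congˡ (horner-* p q))) ⟩
      ι a * horner q y + (0# + y * (horner p y * horner q y))
        ≈⟨ solve 4 (λ a y p q → a :* q :+ (con 0 :+ y :* (p :* q)) := (a :+ y :* p) :* q) refl (ι a) y
          (horner p y) (horner q y) ⟩
      (ι a + y * horner p y) * horner q y                      ∎

    horner-1 : horner 1ᴾ y ≈ 1#
    horner-1 = trans (+-cong ι-1 (zeroʳ y)) (+-identityʳ 1#)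

    horner-X : horner X y ≈ y
    horner-X = trans (+-cong ι-0 (*-congˡ horner-1)) (trans (+-identityˡ _) (*-identityʳ y))

    horner-⊛ : ∀ f g d → horner ((f Poly.⊛ g) d) y ≈ ((λ i → horner (f i) y) ⊛ (λ i → horner (g i) y)) d
    horner-⊛ f g zero    = horner-* (f 0) (g 0)
    horner-⊛ f g (suc d) = trans (horner-+ (((f ∘ suc) Poly.⊛ g) d) ((f Poly.⊛ (g ∘ suc)) d))
      (+-cong (horner-⊛ (f ∘ suc) g d) (horner-⊛ f (g ∘ suc) d))

    horner-touchard : IsTouchard y (λ d → horner (touchard d) y)
    horner-touchard .at-zero  = trans
      (horner-cong (touchard 0) 1ᴾ (touchard-isTouchard .Poly.at-zero)) horner-1
    horner-touchard .at-suc d = begin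
      horner (touchard (suc d)) y
        ≈⟨ horner-cong (touchard (suc d)) (X *ᴾ (Poly.𝟙 Poly.⊛ touchard) d)
          (touchard-isTouchard .Poly.at-suc d) ⟩
      horner (X *ᴾ (Poly.𝟙 Poly.⊛ touchard) d) y                  ≈⟨ horner-* X
        ((Poly.𝟙 Poly.⊛ touchard) d) ⟩
      horner X y * horner ((Poly.𝟙 Poly.⊛ touchard) d) y
        ≈⟨ *-cong horner-X (trans (horner-⊛ Poly.𝟙 touchard d)
          (⊛-cong d (λ _ → horner-1) (λ _ → refl))) ⟩
      y * (𝟙 ⊛ (λ i → horner (touchard i) y)) d             ∎

  horner-congʳ : ∀ p {y z} → y ≈ z → horner p y ≈ horner p z
  horner-congʳ []      e = refl
  horner-congʳ (a ∷ p) e = +-congˡ (*-cong e (horner-congʳ p e))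

  open TreeSums 𝔸 public using (Σ-const)
  Σ-enrichedTrees : ∀ x m → Σ (enrichedTrees (suc m)) (λ T → x ^ blocks T) ≈ horner (touchard m)
    (ν (suc m) * x)
  Σ-enrichedTrees x = TreeSums.Σ-enrichedTrees 𝔸 x (λ y d → horner (touchard d) y) horner-touchard

𝒜≋touchard : ∀ m → 𝒜 (suc m) ≋ touchard m ∘ᴾ (fromℕ (suc m) ·ᴾ X)
𝒜≋touchard m = begin
  𝒜 (suc m)
    ≈⟨ Σ-cong (enrichedTrees (suc m)) (λ T → reflexive (^ᴾ≡^ (blocks T))) ⟩
  Σ (enrichedTrees (suc m)) (λ T → X ^ blocks T)           ≈⟨ Σ-enrichedTrees X m ⟩
  horner (touchard m) ((fromℕ (suc m) ∷ []) *ᴾ X)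
    ≈⟨ horner-congʳ (touchard m) (·ᴾ≋*ᴾ (fromℕ (suc m)) X) ⟨
  horner (touchard m) (fromℕ (suc m) ·ᴾ X)                 ≡⟨ horner≡∘ᴾ (touchard m)
    (fromℕ (suc m) ·ᴾ X) ⟩
  touchard m ∘ᴾ (fromℕ (suc m) ·ᴾ X)                       ∎
  where
  open Sums polynomialAlgebra
  open Horner polynomialAlgebra
  ^ᴾ≡^ : ∀ k → X ^ᴾ k ≡ X ^ k
  ^ᴾ≡^ zero    = ≡-refl
  ^ᴾ≡^ (suc k) = cong (X *ᴾ_) (^ᴾ≡^ k)
  horner≡∘ᴾ : ∀ p q → horner p q ≡ p ∘ᴾ q
  horner≡∘ᴾ []      q = ≡-refl
  horner≡∘ᴾ (a ∷ p) q = cong (λ r → (a ∷ []) +ᴾ q *ᴾ r) (horner≡∘ᴾ p q)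

length-enrichedTrees : ∀ m → fromℕ (length (enrichedTrees (suc m))) ≡ eval (touchard m) (fromℕ (suc m))
length-enrichedTrees m = begin
  fromℕ (length trees)                           ≈⟨ ℚ.*-identityʳ _ ⟨
  fromℕ (length trees) ℚ.* 1ℚ                    ≈⟨ Σ-const trees 1ℚ ⟨
  Σ trees (λ _ → 1ℚ)                             ≈⟨ Σ-cong trees (λ T → ≡-sym (1^ (blocks T))) ⟩
  Σ trees (λ T → 1ℚ ^ blocks T)                  ≈⟨ Σ-enrichedTrees 1ℚ m ⟩
  horner (touchard m) (fromℕ (suc m) ℚ.* 1ℚ)     ≡⟨ cong (horner (touchard m)) (ℚ.*-identityʳ _) ⟩
  horner (touchard m) (fromℕ (suc m))            ≡⟨ horner≡eval (touchard m) (fromℕ (suc m)) ⟩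
  eval (touchard m) (fromℕ (suc m))              ∎
  where
  open Sums rationalAlgebra
  open Horner rationalAlgebra
  trees = enrichedTrees (suc m)
  1^ : ∀ k → 1ℚ ^ k ≡ 1ℚ
  1^ zero    = ≡-refl
  1^ (suc k) = ≡-trans (ℚ.*-identityˡ (1ℚ ^ k)) (1^ k)
  horner≡eval : ∀ p c → horner p c ≡ eval p c
  horner≡eval []      c = ≡-refl
  horner≡eval (a ∷ p) c = cong (λ e → a ℚ.+ c ℚ.* e) (horner≡eval p c)

proposition6 : (n : ℕ) → n ≥ 1 →
    (𝒜 n ≈ᴾ touchard (n ∸ 1) ∘ᴾ (fromℕ n ·ᴾ X)) ×
    (fromℕ (length (enrichedTrees n)) ≡ eval (touchard (n ∸ 1)) (fromℕ n))
proposition6 (suc m) _ = 𝒜≋touchard m .at , length-enrichedTrees m
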